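{- For all integers $3\le r\le n$, \[ \log p(n,r) \le \frac{1}{n-r+1}\binom{n}{r}\log\bigl(\mathrm{e}(n-r+1)\bigr). \]
   Context: $p(n,r)$ denotes the number of paving matroids of rank $r$ on the ground set $[n]=\{1,\dots,n\}$; a matroid of rank $r$ is paving if each of its circuits has cardinality at least $r$. $\log$ is the logarithm to base $2$ and $\mathrm{e}$ is Euler's number. -}

module Defs where

import Algebra.Definitions.RawSemiring as RawSemiring
open import Data.Bool.Properties using () renaming (_≟_ to _≟ᵇ_)
open import Data.Fin.Base using (zero; suc)
open import Data.Fin.Properties using (any?)
open import Data.Fin.Subset as Subset using (Subset; ⁅_⁆; ∣_∣; inside; outside; _⊆_; _⊂_; _∪_)
import Data.Fin.Subset.Properties as Subsetₚ
open import Data.Integer.Base as ℤ using (ℤ; +_; -[1+_])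
import Data.Integer.Properties as ℤₚ
open import Data.List.Base using (List; []; _∷_; [_]; _++_; map; filter; length)
import Data.List.Membership.DecPropositional as DecMembership
open import Data.List.Membership.Propositional using (_∈_)
open import Data.List.Membership.Propositional.Properties
  using (∈-++⁺ˡ; ∈-++⁺ʳ; ∈-map⁺; ∈-filter⁺; ∈-filter⁻)
open import Data.List.Relation.Unary.Any using (here; there)
open import Data.Nat.Base as ℕ using (ℕ; zero; suc; _!; z≤n; s≤s)
import Data.Nat.Coprimality as Coprime
import Data.Nat.Properties as ℕₚ
open import Data.Nat.Tactic.RingSolver using (solve-∀)
open import Data.Product.Base using (∃; _×_; _,_; proj₁; proj₂)
open import Data.Rational.Base as ℚ using (ℚ; mkℚ; 0ℚ; 1ℚ; _/_; toℚᵘ)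
import Data.Rational.Properties as ℚₚ
open import Data.Rational.Unnormalised.Base as ℚᵘ using (mkℚᵘ)
import Data.Rational.Unnormalised.Properties as ℚᵘₚ
open import Data.Vec.Base as Vec using ([]; _∷_)
open import Data.Vec.Properties using (≡-dec)
open import Level using (0ℓ)
open import Relation.Binary.PropositionalEquality
  using (_≡_; refl; sym; trans; cong; subst; subst₂)
open import Relation.Nullary using (Dec; yes; no; ¬_; contradiction)
open import Relation.Nullary.Decidable
  using (map′; _×-dec_; _→-dec_; ¬?; decidable-stable; toWitness)
open import Relation.Unary using (Pred; Decidable)

private
  variable
    n : ℕ

record IsMatroid (ℐ : Pred (Subset n) 0ℓ) : Set where
  field
    ∅-indep    : ℐ Subset.⊥
    hereditary : ∀ A B → A ⊆ B → ℐ B → ℐ A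
    augment    : ∀ A B → ℐ A → ℐ B → ∣ A ∣ ℕ.< ∣ B ∣ →
                 ∃ λ x → x Subset.∈ B × x Subset.∉ A × ℐ (A ∪ ⁅ x ⁆)

HasRank : Pred (Subset n) 0ℓ → ℕ → Set
HasRank ℐ r = (∃ λ B → ℐ B × ∣ B ∣ ≡ r) × (∀ A → ℐ A → ∣ A ∣ ℕ.≤ r)

IsCircuit : Pred (Subset n) 0ℓ → Pred (Subset n) 0ℓ
IsCircuit ℐ C = ¬ ℐ C × (∀ A → A ⊂ C → ℐ A)

record IsPavingMatroid (r : ℕ) (ℐ : Pred (Subset n) 0ℓ) : Set where
  field
    isMatroid : IsMatroid ℐ
    hasRank   : HasRank ℐ r
    paving    : ∀ C → IsCircuit ℐ C → r ℕ.≤ ∣ C ∣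

private
  allSubsets? : {P : Pred (Subset n) 0ℓ} → Decidable P → Dec (∀ A → P A)
  allSubsets? P? with Subsetₚ.anySubset? (λ A → ¬? (P? A))
  ... | yes (A , ¬PA) = no λ f → ¬PA (f A)
  ... | no  ¬∃        = yes λ A → decidable-stable (P? A) λ ¬PA → ¬∃ (A , ¬PA)

  isMatroid? : {ℐ : Pred (Subset n) 0ℓ} → Decidable ℐ → Dec (IsMatroid ℐ)
  isMatroid? ℐ? = map′
    (λ (a , b , c) → record { ∅-indep = a ; hereditary = b ; augment = c })
    (λ m → let open IsMatroid m in ∅-indep , hereditary , augment)
    (ℐ? Subset.⊥
      ×-dec (allSubsets? λ A → allSubsets? λ B →
               (A Subsetₚ.⊆? B) →-dec (ℐ? B →-dec ℐ? A))
      ×-dec (allSubsets? λ A → allSubsets? λ B →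
               ℐ? A →-dec (ℐ? B →-dec ((∣ A ∣ ℕₚ.<? ∣ B ∣) →-dec
                 any? λ x → (x Subsetₚ.∈? B) ×-dec
                            (¬? (x Subsetₚ.∈? A) ×-dec ℐ? (A ∪ ⁅ x ⁆))))))

isPavingMatroid? : ∀ r {ℐ : Pred (Subset n) 0ℓ} → Decidable ℐ → Dec (IsPavingMatroid r ℐ)
isPavingMatroid? r ℐ? = map′
  (λ (a , b , c) → record { isMatroid = a ; hasRank = b ; paving = c })
  (λ m → let open IsPavingMatroid m in isMatroid , hasRank , paving)
  (isMatroid? ℐ?
    ×-dec (Subsetₚ.anySubset? (λ B → ℐ? B ×-dec (∣ B ∣ ℕₚ.≟ r))
             ×-dec allSubsets? (λ A → ℐ? A →-dec (∣ A ∣ ℕₚ.≤? r)))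
    ×-dec (allSubsets? λ C →
             (¬? (ℐ? C) ×-dec (allSubsets? λ A → (A Subsetₚ.⊂? C) →-dec ℐ? A))
               →-dec (r ℕₚ.≤? ∣ C ∣)))

_∈ˡ?_ : ∀ (A : Subset n) 𝓕 → Dec (A ∈ 𝓕)
_∈ˡ?_ = DecMembership._∈?_ (≡-dec _≟ᵇ_)

subsets : ∀ n → List (Subset n)
subsets zero    = [ [] ]
subsets (suc n) = map (outside ∷_) (subsets n) ++ map (inside ∷_) (subsets n)

sublists : {A : Set} → List A → List (List A)
sublists []       = [ [] ]
sublists (x ∷ xs) = sublists xs ++ map (x ∷_) (sublists xs)

-- Every subset of Fin n occurs exactly once in `subsets n`, so every set of
-- subsets of Fin n is the set of members of exactly one entry of `families n`.
families : ∀ n → List (List (Subset n))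
families n = sublists (subsets n)

-- The number of paving matroids of rank r on the ground set Fin n (labelled:
-- two matroids are the same when they have the same independent sets).
p : ℕ → ℕ → ℕ
p n r = length (filter (λ 𝓕 → isPavingMatroid? r {_∈ 𝓕} (_∈ˡ? 𝓕)) (families n))

-- log₂ (p n r) needs p n r > 0: for r ≤ n the uniform matroid is counted.

private
  ∈-subsets : ∀ (A : Subset n) → A ∈ subsets n
  ∈-subsets []            = here refl
  ∈-subsets (outside ∷ A) = ∈-++⁺ˡ (∈-map⁺ (outside ∷_) (∈-subsets A))
  ∈-subsets (inside ∷ A)  = ∈-++⁺ʳ (map (outside ∷_) (subsets _)) (∈-map⁺ (inside ∷_) (∈-subsets A))

  filter∈sublists : {A : Set} {P : Pred A 0ℓ} (P? : Decidable P) →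
                    ∀ xs → filter P? xs ∈ sublists xs
  filter∈sublists P? []       = here refl
  filter∈sublists P? (x ∷ xs) with P? x
  ... | yes _ = ∈-++⁺ʳ (sublists xs) (∈-map⁺ (x ∷_) (filter∈sublists P? xs))
  ... | no  _ = ∈-++⁺ˡ (filter∈sublists P? xs)

  0<length : {A : Set} {x : A} {xs : List A} → x ∈ xs → 0 ℕ.< length xs
  0<length (here _)  = s≤s z≤n
  0<length (there _) = s≤s z≤n

  ∣A∪⁅x⁆∣≤ : ∀ (A : Subset n) x → ∣ A ∪ ⁅ x ⁆ ∣ ℕ.≤ suc ∣ A ∣
  ∣A∪⁅x⁆∣≤ (inside  ∷ A) zero    rewrite Subsetₚ.∪-identityʳ A = ℕₚ.n≤1+n _
  ∣A∪⁅x⁆∣≤ (outside ∷ A) zero    rewrite Subsetₚ.∪-identityʳ A = ℕₚ.≤-refl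
  ∣A∪⁅x⁆∣≤ (inside  ∷ A) (suc x) = s≤s (∣A∪⁅x⁆∣≤ A x)
  ∣A∪⁅x⁆∣≤ (outside ∷ A) (suc x) = ∣A∪⁅x⁆∣≤ A x

  ofSize : ∀ {r n} → r ℕ.≤ n → ∃ λ (B : Subset n) → ∣ B ∣ ≡ r
  ofSize {n = n} z≤n = Subset.⊥ , Subsetₚ.∣⊥∣≡0 n
  ofSize (s≤s r≤n)   = let B , eq = ofSize r≤n in inside ∷ B , cong suc eq

  larger : ∀ (A B : Subset n) → ∣ A ∣ ℕ.< ∣ B ∣ → ∃ λ x → x Subset.∈ B × x Subset.∉ A
  larger A B A<B with any? (λ x → (x Subsetₚ.∈? B) ×-dec ¬? (x Subsetₚ.∈? A))
  ... | yes found = found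
  ... | no  none  = contradiction (Subsetₚ.p⊆q⇒∣p∣≤∣q∣ B⊆A) (ℕₚ.<⇒≱ A<B)
    where
    B⊆A : B ⊆ A
    B⊆A {x} x∈B = decidable-stable (x Subsetₚ.∈? A) λ x∉A → none (x , x∈B , x∉A)

module _ {n r : ℕ} (r≤n : r ℕ.≤ n) where

  private
    small? : Decidable (λ (A : Subset n) → ∣ A ∣ ℕ.≤ r)
    small? A = ∣ A ∣ ℕₚ.≤? r

    uniform : List (Subset n)
    uniform = filter small? (subsets n)

    to : ∀ {A} → ∣ A ∣ ℕ.≤ r → A ∈ uniform
    to {A} = ∈-filter⁺ small? (∈-subsets A)

    from : ∀ {A} → A ∈ uniform → ∣ A ∣ ℕ.≤ r
    from A∈ = proj₂ (∈-filter⁻ small? {xs = subsets n} A∈)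

    uniform-isPaving : IsPavingMatroid r (_∈ uniform)
    uniform-isPaving = record
      { isMatroid = record
        { ∅-indep    = to (subst (ℕ._≤ r) (sym (Subsetₚ.∣⊥∣≡0 n)) z≤n)
        ; hereditary = λ A B A⊆B B∈ → to (ℕₚ.≤-trans (Subsetₚ.p⊆q⇒∣p∣≤∣q∣ A⊆B) (from B∈))
        ; augment    = λ A B A∈ B∈ A<B →
            let x , x∈B , x∉A = larger A B A<B
            in  x , x∈B , x∉A , to (ℕₚ.≤-trans (∣A∪⁅x⁆∣≤ A x) (ℕₚ.≤-trans A<B (from B∈)))
        }
      ; hasRank = (let B , eq = ofSize r≤n in B , to (ℕₚ.≤-reflexive eq) , eq)
                , λ A → from
      ; paving = λ C (C∉ , _) → ℕₚ.≰⇒≥ λ C≤r → C∉ (to C≤r)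
      }

  p-positive : 0 ℕ.< p n r
  p-positive = 0<length
    (∈-filter⁺ (λ 𝓕 → isPavingMatroid? r {_∈ 𝓕} (_∈ˡ? 𝓕))
               (filter∈sublists small? (subsets n)) uniform-isPaving)

-- Real numbers are Dedekind cuts, each given by its lower set { q ∈ ℚ | q < x } and
-- ordered by inclusion.  No locatedness is required, so constructively these are the
-- lower reals; classically they are the usual ones.

record ℝ : Set₁ where
  field
    _∋_       : Pred ℚ 0ℓ
    inhabited : ∃ _∋_
    bounded   : ∃ λ b → ∀ {q} → _∋_ q → q ℚ.≤ b
    downward  : ∀ {q s} → q ℚ.< s → _∋_ s → _∋_ q
    rounded   : ∀ {q} → _∋_ q → ∃ λ s → q ℚ.< s × _∋_ s

open ℝ public using (_∋_)

infix 4 _≤ᴿ_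
_≤ᴿ_ : ℝ → ℝ → Set
x ≤ᴿ y = ∀ q → x ∋ q → y ∋ q

Positive : ℝ → Set
Positive x = x ∋ 0ℚ

private
  q-1<q : ∀ q → q ℚ.+ ℚ.- 1ℚ ℚ.< q
  q-1<q q = subst (q ℚ.+ ℚ.- 1ℚ ℚ.<_) (ℚₚ.+-identityʳ q)
    (ℚₚ.+-monoʳ-< q (toWitness {a? = ℚ.- 1ℚ ℚₚ.<? 0ℚ} _))

sup : (P : Pred ℚ 0ℓ) → ∃ P → (∃ λ b → ∀ {q} → P q → q ℚ.≤ b) → ℝ
sup P (s₀ , Ps₀) (b , P≤b) = record
  { _∋_       = λ q → ∃ λ s → P s × q ℚ.< s
  ; inhabited = s₀ ℚ.+ ℚ.- 1ℚ , s₀ , Ps₀ , q-1<q s₀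
  ; bounded   = b , λ (s , Ps , q<s) → ℚₚ.<⇒≤ (ℚₚ.<-≤-trans q<s (P≤b Ps))
  ; downward  = λ q<q′ (s , Ps , q′<s) → s , Ps , ℚₚ.<-trans q<q′ q′<s
  ; rounded   = λ (s , Ps , q<s) → let m , q<m , m<s = ℚₚ.<-dense q<s
                                   in  m , q<m , s , Ps , m<s
  }

fromℚ : ℚ → ℝ
fromℚ c = sup (_≡ c) (c , refl) (c , ℚₚ.≤-reflexive)

fromℕ : ℕ → ℝ
fromℕ k = fromℚ (+ k / 1)

scale : (c : ℚ) .{{_ : ℚ.NonNegative c}} → ℝ → ℝ
scale c x = sup (λ s → ∃ λ q → x ∋ q × s ≡ c ℚ.* q)
  (let q , q∈x = ℝ.inhabited x in c ℚ.* q , q , q∈x , refl)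
  (let b , x≤b = ℝ.bounded x in c ℚ.* b ,
     λ { (q , q∈x , refl) → ℚₚ.*-monoˡ-≤-nonNeg c (x≤b q∈x) })

infixr 7 _·_
_·_ : ℕ → ℝ → ℝ
k · x = scale (+ k / 1) {{ℚₚ.normalize-nonNeg k 1}} x

infixl 7 _÷_
_÷_ : ℝ → (m : ℕ) .{{_ : ℕ.NonZero m}} → ℝ
x ÷ m = scale (+ 1 / m) {{ℚₚ.normalize-nonNeg 1 m}} x

private
  /-≤ : ∀ i m j n → i ℤ.* + suc n ℤ.≤ j ℤ.* + suc m → i / suc m ℚ.≤ j / suc n
  /-≤ i m j n h = ℚₚ.toℚᵘ-cancel-≤
    (ℚᵘₚ.≤-respˡ-≃ (ℚᵘₚ.≃-sym (ℚₚ.toℚᵘ-fromℚᵘ (mkℚᵘ i m)))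
      (ℚᵘₚ.≤-respʳ-≃ (ℚᵘₚ.≃-sym (ℚₚ.toℚᵘ-fromℚᵘ (mkℚᵘ j n))) (ℚᵘ.*≤* h)))

  1/d+1/d≤1/f : ∀ f d .{{_ : ℕ.NonZero f}} .{{_ : ℕ.NonZero d}} → 2 ℕ.* f ℕ.≤ d →
                (+ 1 / d) ℚ.+ (+ 1 / d) ℚ.≤ + 1 / f
  1/d+1/d≤1/f (suc f) (suc d) h = ℚₚ.toℚᵘ-cancel-≤ (begin
    toℚᵘ (1/d ℚ.+ 1/d)          ≃⟨ ℚₚ.toℚᵘ-homo-+ 1/d 1/d ⟩
    toℚᵘ 1/d ℚᵘ.+ toℚᵘ 1/d      ≃⟨ ℚᵘₚ.+-cong (ℚₚ.toℚᵘ-fromℚᵘ u) (ℚₚ.toℚᵘ-fromℚᵘ u) ⟩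
    u ℚᵘ.+ u                    ≤⟨ ℚᵘ.*≤* (ℤ.+≤+ ineq) ⟩
    mkℚᵘ (+ 1) f                ≃⟨ ℚᵘₚ.≃-sym (ℚₚ.toℚᵘ-fromℚᵘ (mkℚᵘ (+ 1) f)) ⟩
    toℚᵘ (+ 1 / suc f)          ∎)
    where
    open ℚᵘₚ.≤-Reasoning
    1/d : ℚ
    1/d = + 1 / suc d
    u : ℚᵘ.ℚᵘ
    u = mkℚᵘ (+ 1) d
    ineq : (suc (d ℕ.+ 0) ℕ.+ suc (d ℕ.+ 0)) ℕ.* suc f ℕ.≤ suc d ℕ.* suc d ℕ.+ 0
    ineq = subst₂ ℕ._≤_
      (lhs d f) (sym (ℕₚ.+-identityʳ _))
      (ℕₚ.*-monoʳ-≤ (suc d) h)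
      where
      lhs : ∀ d f → suc d ℕ.* (2 ℕ.* suc f) ≡ (suc (d ℕ.+ 0) ℕ.+ suc (d ℕ.+ 0)) ℕ.* suc f
      lhs = solve-∀

1/_! : ℕ → ℚ
1/ k ! = (+ 1 / k !) {{k ℕₚ.!≢0}}

-- ∑1/ k ! is the sum of 1 / i ! over i < k.
∑1/_! : ℕ → ℚ
∑1/ zero  ! = 0ℚ
∑1/ suc k ! = ∑1/ k ! ℚ.+ 1/ k !

private
  0≤1/k! : ∀ k → 0ℚ ℚ.≤ 1/ k !
  0≤1/k! k = ℚₚ.nonNegative⁻¹ _ {{ℚₚ.normalize-nonNeg 1 (k !) {{k ℕₚ.!≢0}}}}

  ≤+ : ∀ {q s} → 0ℚ ℚ.≤ s → q ℚ.≤ q ℚ.+ s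
  ≤+ {q} {s} 0≤s = subst (ℚ._≤ q ℚ.+ s) (ℚₚ.+-identityʳ q) (ℚₚ.+-monoʳ-≤ q 0≤s)

  ∑≤3-1/k! : ∀ k → ∑1/ 2 ℕ.+ k ! ℚ.+ 1/ suc k ! ℚ.≤ + 3 / 1
  ∑≤3-1/k! zero    = ℚₚ.≤-refl
  ∑≤3-1/k! (suc k) = begin
    ∑1/ 2 ℕ.+ k ! ℚ.+ 1/ 2 ℕ.+ k ! ℚ.+ 1/ 2 ℕ.+ k !     ≡⟨ ℚₚ.+-assoc (∑1/ 2 ℕ.+ k !) _ _ ⟩
    ∑1/ 2 ℕ.+ k ! ℚ.+ (1/ 2 ℕ.+ k ! ℚ.+ 1/ 2 ℕ.+ k !)   ≤⟨ ℚₚ.+-monoʳ-≤ (∑1/ 2 ℕ.+ k !)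
      (1/d+1/d≤1/f (suc k !) ((2 ℕ.+ k) !) {{suc k ℕₚ.!≢0}} {{(2 ℕ.+ k) ℕₚ.!≢0}}
        (ℕₚ.*-mono-≤ {2} {2 ℕ.+ k} {suc k !} (s≤s (s≤s z≤n)) ℕₚ.≤-refl)) ⟩
    ∑1/ 2 ℕ.+ k ! ℚ.+ 1/ suc k !                        ≤⟨ ∑≤3-1/k! k ⟩
    + 3 / 1                                             ∎
    where open ℚₚ.≤-Reasoning

  ∑≤3 : ∀ k → ∑1/ k ! ℚ.≤ + 3 / 1
  ∑≤3 k = ℚₚ.≤-trans (≤+ (0≤1/k! k)) (ℚₚ.≤-trans (≤+ (0≤1/k! (suc k)))
            (ℚₚ.≤-trans (≤+ (0≤1/k! (suc k))) (∑≤3-1/k! k)))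

e : ℝ
e = sup (λ s → ∃ λ k → s ≡ ∑1/ k !) (0ℚ , 0 , refl) (+ 3 / 1 , λ { (k , refl) → ∑≤3 k })

open RawSemiring ℚ.+-*-rawSemiring public using (_^_)

infix 9 2^_
2^_ : ℤ → ℚ
2^ (+ k)    = + (2 ℕ.^ k) / 1
2^ -[1+ k ] = (+ 1 / 2 ℕ.^ suc k) {{ℕₚ.m^n≢0 2 (suc k)}}

private
  ^-mono : ∀ {y z} → 0ℚ ℚ.≤ y → y ℚ.≤ z → ∀ b → 0ℚ ℚ.≤ y ^ b × y ^ b ℚ.≤ z ^ b
  ^-mono         0≤y y≤z zero    = ℚₚ.nonNegative⁻¹ 1ℚ , ℚₚ.≤-refl
  ^-mono {y} {z} 0≤y y≤z (suc b) =
    let 0≤yᵇ , yᵇ≤zᵇ = ^-mono 0≤y y≤z b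
        instance
          y≥0  : ℚ.NonNegative y
          y≥0  = ℚ.nonNegative 0≤y
          z≥0  : ℚ.NonNegative z
          z≥0  = ℚ.nonNegative (ℚₚ.≤-trans 0≤y y≤z)
          yᵇ≥0 : ℚ.NonNegative (y ^ b)
          yᵇ≥0 = ℚ.nonNegative 0≤yᵇ
    in  ℚₚ.nonNegative⁻¹ (y ℚ.* y ^ b) {{ℚₚ.nonNeg*nonNeg⇒nonNeg y (y ^ b)}}
      , ℚₚ.≤-trans (ℚₚ.*-monoʳ-≤-nonNeg (y ^ b) y≤z) (ℚₚ.*-monoˡ-≤-nonNeg z yᵇ≤zᵇ)

  /1≡ : ∀ m → + m / 1 ≡ mkℚ (+ m) 0 (Coprime.sym (Coprime.1-coprimeTo m))
  /1≡ m = ℚₚ.normalize-coprime (Coprime.sym (Coprime.1-coprimeTo m))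

  /1-* : ∀ m n → (+ m / 1) ℚ.* (+ n / 1) ≡ + (m ℕ.* n) / 1
  /1-* m n rewrite /1≡ m | /1≡ n = cong (_/ 1) (sym (ℤₚ.pos-* m n))

  /1-^ : ∀ m b → (+ m / 1) ^ b ≡ + (m ℕ.^ b) / 1
  /1-^ m zero    = refl
  /1-^ m (suc b) = trans (cong ((+ m / 1) ℚ.*_) (/1-^ m b)) (/1-* m (m ℕ.^ b))

  /1-cancel-≤ : ∀ {m n} → + m / 1 ℚ.≤ + n / 1 → m ℕ.≤ n
  /1-cancel-≤ {m} {n} h rewrite /1≡ m | /1≡ n =
    ℤₚ.drop‿+≤+ (subst₂ ℤ._≤_ (ℤₚ.*-identityʳ (+ m)) (ℤₚ.*-identityʳ (+ n)) (ℚₚ.drop-*≤* h))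

  k<2^k : ∀ k → k ℕ.< 2 ℕ.^ k
  k<2^k zero    = s≤s z≤n
  k<2^k (suc k) = ℕₚ.+-mono-≤-< (ℕₚ.≤-trans (s≤s z≤n) (k<2^k k))
                    (subst (k ℕ.<_) (sym (ℕₚ.+-identityʳ (2 ℕ.^ k))) (k<2^k k))

  2^-cancel-≤ : ∀ {a c} → 2 ℕ.^ a ℕ.≤ 2 ℕ.^ c → a ℕ.≤ c
  2^-cancel-≤ {a} {c} h with a ℕₚ.≤? c
  ... | yes a≤c = a≤c
  ... | no  a≰c = contradiction h
        (ℕₚ.<⇒≱ (ℕₚ.^-monoʳ-< 2 (s≤s (s≤s z≤n)) (ℕₚ.≰⇒> a≰c)))

  ≤2^ : ∀ q → ∃ λ k → q ℚ.≤ + (2 ℕ.^ k) / 1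
  ≤2^ q@(mkℚ n d _) = k , subst (ℚ._≤ + (2 ℕ.^ k) / 1) (ℚₚ.↥p/↧p≡p q) (/-≤ n d (+ (2 ℕ.^ ℤ.∣ n ∣)) 0 (h n))
    where
    k : ℕ
    k = ℤ.∣ n ∣
    h : ∀ n → n ℤ.* + 1 ℤ.≤ + (2 ℕ.^ ℤ.∣ n ∣) ℤ.* + suc d
    h n rewrite ℤₚ.*-identityʳ n | sym (ℤₚ.pos-* (2 ℕ.^ ℤ.∣ n ∣) (suc d)) = go n
      where
      go : ∀ n → n ℤ.≤ + (2 ℕ.^ ℤ.∣ n ∣ ℕ.* suc d)
      go (+ m)    = ℤ.+≤+ (ℕₚ.≤-trans (ℕₚ.<⇒≤ (k<2^k m)) (ℕₚ.m≤m*n _ (suc d)))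
      go -[1+ m ] = ℤ.-≤+

  2^≤ : ∀ y → 0ℚ ℚ.< y → ∃ λ a → 2^ a ℚ.≤ y ^ 1
  2^≤ y 0<y with ℚ.positive 0<y
  2^≤ y@(mkℚ (+ suc n) d _) 0<y | _ = -[1+ d ] ,
    subst (2^ -[1+ d ] ℚ.≤_) (trans (ℚₚ.↥p/↧p≡p y) (sym (ℚₚ.*-identityʳ y))) 
      (h (2 ℕ.^ suc d) {{ℕₚ.m^n≢0 2 (suc d)}} (k<2^k (suc d)))
    where
    h : ∀ m .{{_ : ℕ.NonZero m}} → suc d ℕ.< m → (+ 1 / m) ℚ.≤ + suc n / suc d
    h (suc m) d<m = /-≤ (+ 1) m (+ suc n) d (ℤ.+≤+ (ℕₚ.≤-trans (ℕₚ.≤-reflexive (ℕₚ.*-identityˡ (suc d)))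
                      (ℕₚ.≤-trans (ℕₚ.<⇒≤ d<m) (ℕₚ.m≤n*m (suc m) (suc n)))))

-- log₂ x is the supremum of the fractions a / b (b ≥ 1) with 2^a ≤ y^b for some
-- rational 0 < y < x.
log₂ : (x : ℝ) → Positive x → ℝ
log₂ x 0∈x = sup
  (λ s → ∃ λ a → ∃ λ b → ∃ λ y →
     s ≡ a / suc b × x ∋ y × 0ℚ ℚ.< y × 2^ a ℚ.≤ y ^ suc b)
  (let y , 0<y , y∈x = ℝ.rounded x 0∈x
       a , 2^a≤y     = 2^≤ y 0<y
   in  a / 1 , a , 0 , y , refl , y∈x , 0<y , 2^a≤y)
  (let B , x≤B = ℝ.bounded x
       k , B≤K = ≤2^ B
   in  + k / 1 , λ { (a , b , y , refl , y∈x , 0<y , h) →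
         /-≤ a b (+ k) 0 (bound a b k (ℚₚ.≤-trans h
           (subst (y ^ suc b ℚ.≤_) (/1-^ (2 ℕ.^ k) (suc b))
             (proj₂ (^-mono (ℚₚ.<⇒≤ 0<y) (ℚₚ.≤-trans (x≤B y∈x) B≤K) (suc b)))))) })
  where
  bound : ∀ a b k → 2^ a ℚ.≤ + ((2 ℕ.^ k) ℕ.^ suc b) / 1 → a ℤ.* + 1 ℤ.≤ + k ℤ.* + suc b
  bound (+ a) b k h
    rewrite ℤₚ.*-identityʳ (+ a) | sym (ℤₚ.pos-* k (suc b)) | ℕₚ.^-*-assoc 2 k (suc b)
    = ℤ.+≤+ (2^-cancel-≤ (/1-cancel-≤ h))
  bound -[1+ a ] b k h rewrite sym (ℤₚ.pos-* k (suc b)) = ℤ.-≤+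

fromℕ-positive : ∀ k → 0 ℕ.< k → Positive (fromℕ k)
fromℕ-positive (suc k) _ = _ , refl , ℚₚ.positive⁻¹ _ {{ℚₚ.normalize-pos (suc k) 1}}

·-positive : ∀ k .{{_ : ℕ.NonZero k}} x → Positive x → Positive (k · x)
·-positive k x 0∈x =
  let s , 0<s , s∈x = ℝ.rounded x 0∈x
      c = + k / 1
  in  c ℚ.* s , (s , s∈x , refl) ,
      subst (ℚ._< c ℚ.* s) (ℚₚ.*-zeroʳ c)
        (ℚₚ.*-monoʳ-<-pos c {{ℚₚ.normalize-pos k 1}} 0<s)

e-positive : Positive e
e-positive = 1ℚ , (1 , refl) , ℚₚ.positive⁻¹ 1ℚ

{-# OPTIONS --safe #-}
-- A paving matroid of rank r is determined by its dependent r-sets, i.e. by its hyperplanes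
-- H with at least r elements, and such an H can be recorded by the |H| - r + 1 sets B ∪ {h},
-- where B consists of the first r - 1 elements of H and h ranges over H ∖ B.  Every (r-1)-set
-- lies in exactly one hyperplane, and for r ≥ 3 each recorded r-set can be charged to r
-- subsets of H of size r - 1, all of them distinct.  With d = n - r + 1 and N = C(n, r) this
-- bounds the number of recorded sets by C(n, r - 1) / r = N / d, so that
-- p(n, r) ≤ Σ_{i ≤ N/d} C(N, i) ≤ d^(N/d) (1 + 1/d)^N ≤ (e d)^(N/d).
module Submission where

-- A hyperplane of size t ≥ r contributes t - r + 1 recorded sets and contains C(t, r - 1) sets of
-- size r - 1, so charging inside hyperplanes needs r (t - r + 1) ≤ C(t, r - 1). This is an equality
-- at t = r and false for r = 2, t ≥ 3. For D = B ∪ {h} the natural choice is the r subsets of D of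
-- size r - 1, but D - h = B is common to all sets recorded for the same hyperplane. Only one of
-- them can keep B; every other one trades it for a set that still contains its own h, which is
-- possible once B has two elements to give up. Real logarithms are never manipulated. The cut of
-- log₂ is built from integer powers, so it is enough to have p^d ≤ z^N for one rational z strictly
-- below e d. The choice z = d Σ_{i≤d} 1/i! works because (1 + 1/d)^d is bounded by this sum term by
-- term. The d-th power also absorbs the rounding in N / d, and with denominators cleared the
-- estimate stays in ℕ until the end.

-- Counting with duplicate-free lists and their sublists.

module UniqueLists where
  open import Defs using (sublists)
  open import Data.List.Base using (List; []; _∷_; _++_; [_]; map; length; concatMap; filter)
  open import Data.List.Properties using (length-++)
  open import Data.List.Membership.Propositional using (_∈_; find)
  open import Data.List.Membership.Propositional.Properties
  open import Data.List.Relation.Unary.All as All using ([]; _∷_)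
  import Data.List.Relation.Unary.All.Properties as Allₚ
  open import Data.List.Relation.Unary.AllPairs using ([]; _∷_)
  open import Data.List.Relation.Unary.Any using (here; there)
  open import Data.List.Relation.Unary.Unique.Propositional using (Unique)
  open import Data.List.Relation.Unary.Unique.Propositional.Properties
    using (++⁺; map⁺; Unique[x∷xs]⇒x∉xs)
  open import Data.Nat.Base
  open import Data.Nat.Properties
  open import Data.Product.Base using (_,_)
  open import Data.Sum.Base using (inj₁; inj₂)
  open import Level using (0ℓ)
  open import Relation.Binary.PropositionalEquality hiding ([_])
  open import Relation.Nullary using (contradiction; does)
  open import Relation.Unary using (Pred; Decidable)
  open import Data.Bool.Base using (true; false)

  private
    variable
      A B : Set

  unique⇒length≤ : ∀ {xs ys : List A} → Unique xs → (∀ {x} → x ∈ xs → x ∈ ys) → length xs ≤ length ys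
  unique⇒length≤ {xs = []}     []          xs⊆ys = z≤n
  unique⇒length≤ {xs = x ∷ xs} u@(_ ∷ xs!) xs⊆ys with ∈-∃++ (xs⊆ys (here refl))
  ... | as , bs , refl = begin
    suc (length xs)               ≤⟨ s≤s (unique⇒length≤ xs! xs⊆as++bs) ⟩
    suc (length (as ++ bs))       ≡⟨ cong suc (length-++ as) ⟩
    suc (length as + length bs)   ≡⟨ +-suc (length as) (length bs) ⟨
    length as + suc (length bs)   ≡⟨ length-++ as ⟨
    length (as ++ x ∷ bs)         ∎
    where
    open ≤-Reasoning
    xs⊆as++bs : ∀ {y} → y ∈ xs → y ∈ as ++ bs
    xs⊆as++bs y∈xs with ∈-++⁻ as (xs⊆ys (there y∈xs))
    ... | inj₁ y∈as         = ∈-++⁺ˡ y∈as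
    ... | inj₂ (here refl)  = contradiction y∈xs (Unique[x∷xs]⇒x∉xs u)
    ... | inj₂ (there y∈bs) = ∈-++⁺ʳ as y∈bs

  module _ (g : A → List B) where

    unique-concatMap : ∀ {xs} → Unique xs →
      (∀ {x} → x ∈ xs → Unique (g x)) →
      (∀ {x x′ t} → x ∈ xs → x′ ∈ xs → t ∈ g x → t ∈ g x′ → x ≡ x′) →
      Unique (concatMap g xs)
    unique-concatMap []           g! disj = []
    unique-concatMap {x ∷ xs} u@(_ ∷ xs!) g! disj =
      ++⁺ (g! (here refl))
          (unique-concatMap xs! (λ x∈ → g! (there x∈)) (λ x∈ x′∈ → disj (there x∈) (there x′∈)))
          λ (t∈gx , t∈rest) → let x′ , x′∈xs , t∈gx′ = find (∈-concatMap⁻ g t∈rest) in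
            contradiction (subst (_∈ xs) (sym (disj (here refl) (there x′∈xs) t∈gx t∈gx′)) x′∈xs)
                          (Unique[x∷xs]⇒x∉xs u)

    length-concatMap : ∀ {m} xs → (∀ {x} → x ∈ xs → length (g x) ≡ m) →
      length (concatMap g xs) ≡ length xs * m
    length-concatMap []       h = refl
    length-concatMap (x ∷ xs) h = trans (length-++ (g x))
      (cong₂ _+_ (h (here refl)) (length-concatMap xs (λ x∈ → h (there x∈))))

    -- The form in which a charging argument is counted: each `x` owns a block of `m` entries of
    -- `ys`, and the blocks are disjoint, so their concatenation is duplicate-free.
    disjoint-lists⇒length*≤ : ∀ {xs ys m} → Unique xs →
      (∀ {x} → x ∈ xs → Unique (g x)) →
      (∀ {x} → x ∈ xs → length (g x) ≡ m) →
      (∀ {x t} → x ∈ xs → t ∈ g x → t ∈ ys) →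
      (∀ {x x′ t} → x ∈ xs → x′ ∈ xs → t ∈ g x → t ∈ g x′ → x ≡ x′) →
      length xs * m ≤ length ys
    disjoint-lists⇒length*≤ {xs} {ys} {m} xs! g! len g⊆ys disj = subst (_≤ length ys) (length-concatMap xs len)
      (unique⇒length≤ (unique-concatMap xs! g! disj) λ t∈ →
        let x , x∈xs , t∈gx = find (∈-concatMap⁻ g t∈) in g⊆ys x∈xs t∈gx)

  injection⇒length≤ : ∀ (f : A → B) {xs ys} → Unique xs →
    (∀ {x} → x ∈ xs → f x ∈ ys) →
    (∀ {x x′} → x ∈ xs → x′ ∈ xs → f x ≡ f x′ → x ≡ x′) →
    length xs ≤ length ys
  injection⇒length≤ f {xs} {ys} xs! f∈ys inj = subst (_≤ length ys) (*-identityʳ (length xs))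
    (disjoint-lists⇒length*≤ (λ x → [ f x ]) xs! (λ _ → [] ∷ []) (λ _ → refl)
      (λ { x∈ (here refl) → f∈ys x∈ })
      (λ { x∈ x′∈ (here refl) (here fx≡fx′) → inj x∈ x′∈ fx≡fx′ }))

  unique-map : ∀ (f : A → B) {xs} → Unique xs →
    (∀ {x x′} → x ∈ xs → x′ ∈ xs → f x ≡ f x′ → x ≡ x′) → Unique (map f xs)
  unique-map f []         inj = []
  unique-map f (x∉ ∷ xs!) inj =
    Allₚ.map⁺ (All.tabulate λ x′∈ eq → All.lookup x∉ x′∈ (inj (here refl) (there x′∈) eq))
    ∷ unique-map f xs! λ x∈ x′∈ → inj (there x∈) (there x′∈)

  length-filter-map : ∀ {P : Pred B 0ℓ} (P? : Decidable P) (f : A → B) xs →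
    length (filter P? (map f xs)) ≡ length (filter (λ x → P? (f x)) xs)
  length-filter-map P? f []       = refl
  length-filter-map P? f (x ∷ xs) with does (P? (f x))
  ... | true  = cong suc (length-filter-map P? f xs)
  ... | false = length-filter-map P? f xs

  sublists-⊆ : ∀ {ys} (xs : List A) → ys ∈ sublists xs → ∀ {y} → y ∈ ys → y ∈ xs
  sublists-⊆ []       (here refl) ()
  sublists-⊆ (x ∷ xs) ys∈ y∈ with ∈-++⁻ (sublists xs) ys∈
  ... | inj₁ ys∈′ = there (sublists-⊆ xs ys∈′ y∈)
  ... | inj₂ ys∈′ with ∈-map⁻ (x ∷_) ys∈′
  ... | zs , zs∈ , refl with y∈
  ... | here refl = here refl
  ... | there y∈′ = there (sublists-⊆ xs zs∈ y∈′)

  unique-sublists : ∀ {xs : List A} → Unique xs → Unique (sublists xs)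
  unique-sublists []            = [] ∷ []
  unique-sublists {xs = x ∷ xs} u@(_ ∷ xs!) =
    ++⁺ (unique-sublists xs!) (map⁺ (λ { refl → refl }) (unique-sublists xs!)) λ (l∈ , l∈′) →
      contradiction (sublists-⊆ xs l∈ (∈-map∷⁻ l∈′)) (Unique[x∷xs]⇒x∉xs u)

  -- A sublist inherits the order of `xs`, so membership alone fixes it. This turns agreement of two
  -- matroids on independence into equality of the listed families.
  sublists-ext : ∀ {xs : List A} → Unique xs → ∀ {as bs} → as ∈ sublists xs → bs ∈ sublists xs →
    (∀ {x} → x ∈ as → x ∈ bs) → (∀ {x} → x ∈ bs → x ∈ as) → as ≡ bs
  sublists-ext []  (here refl) (here refl) _ _ = refl
  sublists-ext {xs = x ∷ xs} u@(_ ∷ xs!) as∈ bs∈ as⊆bs bs⊆as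
    with ∈-++⁻ (sublists xs) as∈ | ∈-++⁻ (sublists xs) bs∈
  ... | inj₁ as∈′ | inj₁ bs∈′ = sublists-ext xs! as∈′ bs∈′ as⊆bs bs⊆as
  ... | inj₁ as∈′ | inj₂ bs∈′ =
    contradiction (sublists-⊆ xs as∈′ (bs⊆as (∈-map∷⁻ bs∈′))) (Unique[x∷xs]⇒x∉xs u)
  ... | inj₂ as∈′ | inj₁ bs∈′ =
    contradiction (sublists-⊆ xs bs∈′ (as⊆bs (∈-map∷⁻ as∈′))) (Unique[x∷xs]⇒x∉xs u)
  ... | inj₂ as∈′ | inj₂ bs∈′ with ∈-map⁻ (x ∷_) as∈′ | ∈-map⁻ (x ∷_) bs∈′
  ... | as , as∈″ , refl | bs , bs∈″ , refl =
    cong (x ∷_) (sublists-ext xs! as∈″ bs∈″ (tail as∈″ as⊆bs) (tail bs∈″ bs⊆as))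
    where
    tail : ∀ {cs ds} → cs ∈ sublists xs → (∀ {y} → y ∈ x ∷ cs → y ∈ x ∷ ds) → ∀ {y} → y ∈ cs → y ∈ ds
    tail cs∈ ⊆ y∈ with ⊆ (there y∈)
    ... | here refl = contradiction (sublists-⊆ xs cs∈ y∈) (Unique[x∷xs]⇒x∉xs u)
    ... | there y∈′ = y∈′

  filter∈sublists : {P : Pred A 0ℓ} (P? : Decidable P) → ∀ xs → filter P? xs ∈ sublists xs
  filter∈sublists P? []       = here refl
  filter∈sublists P? (x ∷ xs) with does (P? x)
  ... | true  = ∈-++⁺ʳ (sublists xs) (∈-map⁺ (x ∷_) (filter∈sublists P? xs))
  ... | false = ∈-++⁺ˡ (filter∈sublists P? xs)

open UniqueLists

-- Subsets of a fixed size, and the number of short sublists.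

module SubsetLists where
  open import Defs using (subsets; sublists)
  open import Data.Fin.Subset using (Subset; ∣_∣; inside; outside)
  open import Data.List.Base using (List; []; _∷_; _++_; map; length; filter)
  open import Data.List.Properties using (length-++; filter-++; filter-≐; filter-none)
  open import Data.List.Membership.Propositional using (_∈_)
  open import Data.List.Membership.Propositional.Properties
  open import Data.List.Relation.Unary.All as All using ([]; _∷_)
  import Data.List.Relation.Unary.All.Properties as Allₚ
  open import Data.List.Relation.Unary.AllPairs using ([]; _∷_)
  open import Data.List.Relation.Unary.Any using (here)
  open import Data.List.Relation.Unary.Unique.Propositional using (Unique)
  open import Data.List.Relation.Unary.Unique.Propositional.Properties using (++⁺; map⁺; filter⁺)
  open import Data.Nat.Base
  open import Data.Nat.Combinatorics using (_C_; nCk+nC[k+1]≡[n+1]C[k+1])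
  open import Data.Nat.Properties
  open import Data.Nat.Tactic.RingSolver using (solve-∀)
  open import Data.Product.Base using (_×_; _,_; proj₂)
  open import Data.Vec.Base using ([]; _∷_)
  open import Relation.Binary.PropositionalEquality hiding ([_])
  open import Relation.Nullary using (¬_)

  ∈-subsets : ∀ {n} (A : Subset n) → A ∈ subsets n
  ∈-subsets []            = here refl
  ∈-subsets (outside ∷ A) = ∈-++⁺ˡ (∈-map⁺ (outside ∷_) (∈-subsets A))
  ∈-subsets (inside ∷ A)  = ∈-++⁺ʳ (map (outside ∷_) (subsets _)) (∈-map⁺ (inside ∷_) (∈-subsets A))

  unique-subsets : ∀ n → Unique (subsets n)
  unique-subsets zero    = [] ∷ []
  unique-subsets (suc n) =
    ++⁺ (map⁺ (λ { refl → refl }) (unique-subsets n)) (map⁺ (λ { refl → refl }) (unique-subsets n)) disj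
    where
    disj : ∀ {A} → ¬ (A ∈ map (outside ∷_) (subsets n) × A ∈ map (inside ∷_) (subsets n))
    disj (o , i) with ∈-map⁻ (outside ∷_) o | ∈-map⁻ (inside ∷_) i
    ... | _ , _ , refl | _ , _ , ()

  subsetsOfSize : ∀ n → ℕ → List (Subset n)
  subsetsOfSize n k = filter (λ A → ∣ A ∣ ≟ k) (subsets n)

  unique-subsetsOfSize : ∀ n k → Unique (subsetsOfSize n k)
  unique-subsetsOfSize n k = filter⁺ (λ A → ∣ A ∣ ≟ k) (unique-subsets n)

  ∈-subsetsOfSize⁺ : ∀ {n k} {A : Subset n} → ∣ A ∣ ≡ k → A ∈ subsetsOfSize n k
  ∈-subsetsOfSize⁺ {k = k} {A} = ∈-filter⁺ (λ A → ∣ A ∣ ≟ k) (∈-subsets A)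

  ∈-subsetsOfSize⁻ : ∀ {n k} {A : Subset n} → A ∈ subsetsOfSize n k → ∣ A ∣ ≡ k
  ∈-subsetsOfSize⁻ {n} {k} A∈ = proj₂ (∈-filter⁻ (λ A → ∣ A ∣ ≟ k) {xs = subsets n} A∈)

  length-subsetsOfSize : ∀ n k → length (subsetsOfSize n k) ≡ n C k
  length-subsetsOfSize zero    zero    = refl
  length-subsetsOfSize zero    (suc k) = refl
  length-subsetsOfSize (suc n) k = begin
    length (filter P? (map (outside ∷_) (subsets n) ++ map (inside ∷_) (subsets n)))
      ≡⟨ cong length (filter-++ P? (map (outside ∷_) (subsets n)) _) ⟩
    length (filter P? (map (outside ∷_) (subsets n)) ++ filter P? (map (inside ∷_) (subsets n)))
      ≡⟨ length-++ (filter P? (map (outside ∷_) (subsets n))) ⟩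
    length (filter P? (map (outside ∷_) (subsets n))) + length (filter P? (map (inside ∷_) (subsets n)))
      ≡⟨ cong₂ _+_ (length-filter-map P? (outside ∷_) (subsets n)) (length-filter-map P? (inside ∷_) (subsets n)) ⟩
    length (subsetsOfSize n k) + length (filter (λ A → suc ∣ A ∣ ≟ k) (subsets n))
      ≡⟨ cong (_+ length (filter (λ A → suc ∣ A ∣ ≟ k) (subsets n))) (length-subsetsOfSize n k) ⟩
    n C k + length (filter (λ A → suc ∣ A ∣ ≟ k) (subsets n))
      ≡⟨ step k ⟩
    suc n C k ∎
    where
    open ≡-Reasoning
    P? = λ (A : Subset (suc n)) → ∣ A ∣ ≟ k
    step : ∀ k → n C k + length (filter (λ A → suc ∣ A ∣ ≟ k) (subsets n)) ≡ suc n C k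
    step zero    = cong (λ xs → 1 + length xs)
      (filter-none (λ A → suc ∣ A ∣ ≟ 0) (All.universal (λ _ ()) (subsets n)))
    step (suc k) = begin
      n C suc k + length (filter (λ A → suc ∣ A ∣ ≟ suc k) (subsets n))
        ≡⟨ cong (λ xs → n C suc k + length xs)
             (filter-≐ (λ A → suc ∣ A ∣ ≟ suc k) (λ A → ∣ A ∣ ≟ k) (suc-injective , cong suc) (subsets n)) ⟩
      n C suc k + length (subsetsOfSize n k) ≡⟨ cong (n C suc k +_) (length-subsetsOfSize n k) ⟩
      n C suc k + n C k                      ≡⟨ +-comm (n C suc k) (n C k) ⟩
      n C k + n C suc k                      ≡⟨ nCk+nC[k+1]≡[n+1]C[k+1] n k ⟩
      suc n C suc k                          ∎

  shortSublists : {A : Set} → ℕ → List A → List (List A)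
  shortSublists m xs = filter (λ ys → length ys ≤? m) (sublists xs)

  private
    length-shortSublists-0 : {A : Set} (xs : List A) → length (shortSublists 0 xs) ≡ 1
    length-shortSublists-0 []       = refl
    length-shortSublists-0 (x ∷ xs) = begin
      length (shortSublists 0 (x ∷ xs))
        ≡⟨ cong length (filter-++ P? (sublists xs) _) ⟩
      length (shortSublists 0 xs ++ filter P? (map (x ∷_) (sublists xs)))
        ≡⟨ length-++ (shortSublists 0 xs) ⟩
      length (shortSublists 0 xs) + length (filter P? (map (x ∷_) (sublists xs)))
        ≡⟨ cong₂ (λ k ys → k + length ys) (length-shortSublists-0 xs)
             (filter-none P? (Allₚ.map⁺ (All.universal (λ _ ()) (sublists xs)))) ⟩
      1 ∎
      where
      open ≡-Reasoning
      P? = λ (ys : List _) → length ys ≤? 0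

    -- Pascal's rule for the partial sums Σ_{i≤m} C(N, i): a sublist either skips `x` or spends one
    -- of its places on it.
    length-shortSublists-∷ : {A : Set} (x : A) → ∀ m xs →
      length (shortSublists (suc m) (x ∷ xs)) ≡
      length (shortSublists (suc m) xs) + length (shortSublists m xs)
    length-shortSublists-∷ x m xs = begin
      length (shortSublists (suc m) (x ∷ xs))
        ≡⟨ cong length (filter-++ P? (sublists xs) _) ⟩
      length (shortSublists (suc m) xs ++ filter P? (map (x ∷_) (sublists xs)))
        ≡⟨ length-++ (shortSublists (suc m) xs) ⟩
      length (shortSublists (suc m) xs) + length (filter P? (map (x ∷_) (sublists xs)))
        ≡⟨ cong (length (shortSublists (suc m) xs) +_)
             (trans (length-filter-map P? (x ∷_) (sublists xs))
                    (cong length (filter-≐ (λ ys → suc (length ys) ≤? suc m) (λ ys → length ys ≤? m)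
                                           (s≤s⁻¹ , s≤s) (sublists xs)))) ⟩
      length (shortSublists (suc m) xs) + length (shortSublists m xs) ∎
      where
      open ≡-Reasoning
      P? = λ (ys : List _) → length ys ≤? suc m

  -- Chernoff's bound Σ_{i≤m} (N choose i) ≤ x⁻ᵐ (1 + x)ᴺ at x = 1 / d, cleared of fractions.
  length-shortSublists : {A : Set} (d : ℕ) .{{_ : NonZero d}} → ∀ m (xs : List A) →
    length (shortSublists m xs) * d ^ length xs ≤ d ^ m * suc d ^ length xs
  length-shortSublists d m []       rewrite *-identityʳ (d ^ m) = m^n>0 d m
  length-shortSublists d zero xs@(_ ∷ _) rewrite length-shortSublists-0 xs =
    +-monoˡ-≤ 0 (^-monoˡ-≤ (length xs) (n≤1+n d))
  length-shortSublists d (suc m) (x ∷ xs) = begin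
    length (shortSublists (suc m) (x ∷ xs)) * (d * dᴺ)
      ≡⟨ cong (_* (d * dᴺ)) (length-shortSublists-∷ x m xs) ⟩
    (length (shortSublists (suc m) xs) + length (shortSublists m xs)) * (d * dᴺ)
      ≡⟨ lhs (length (shortSublists (suc m) xs)) (length (shortSublists m xs)) d dᴺ ⟩
    d * (length (shortSublists (suc m) xs) * dᴺ) + d * (length (shortSublists m xs) * dᴺ)
      ≤⟨ +-mono-≤ (*-monoʳ-≤ d (length-shortSublists d (suc m) xs))
                  (*-monoʳ-≤ d (length-shortSublists d m xs)) ⟩
    -- The two inductive bounds differ by a factor `d`, so their sum carries `d + 1`, the new factor
    -- of the power of `suc d`.
    d * (d * d ^ m * suc d ^ length xs) + d * (d ^ m * suc d ^ length xs)
      ≡⟨ rhs d (d ^ m) (suc d ^ length xs) ⟩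
    d * d ^ m * (suc d * suc d ^ length xs) ∎
    where
    open ≤-Reasoning
    dᴺ = d ^ length xs
    lhs : ∀ a b d e → (a + b) * (d * e) ≡ d * (a * e) + d * (b * e)
    lhs = solve-∀
    rhs : ∀ d a b → d * (d * a * b) + d * (a * b) ≡ d * a * (suc d * b)
    rhs = solve-∀

open SubsetLists

-- Cardinalities of finite subsets, and initial segments of a subset.

module SubsetFacts where
  open import Data.Fin.Base using (Fin; zero; suc)
  open import Data.Fin.Properties using (any?)
  open import Data.Fin.Subset
  open import Data.Fin.Subset.Properties
  open import Data.List.Base as List using (List; []; _∷_)
  import Data.List.Membership.Propositional as List
  import Data.List.Membership.Propositional.Properties as Listₚ
  open import Data.List.Properties using (length-map)
  import Data.List.Relation.Unary.All as All
  import Data.List.Relation.Unary.All.Properties as Allₚ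
  open import Data.List.Relation.Unary.AllPairs using ([]; _∷_)
  open import Data.List.Relation.Unary.Any using (here; there)
  open import Data.List.Relation.Unary.Unique.Propositional using (Unique)
  open import Data.List.Relation.Unary.Unique.Propositional.Properties using (map⁺)
  open import Data.Nat.Base using (ℕ; zero; suc; _+_; _≤_; _<_; s≤s)
  open import Data.Nat.Properties using (<⇒≱; <-irrefl; +-suc; +-comm)
  open import Data.Product.Base using (_×_; _,_; ∃)
  open import Data.Sum.Base using ([_,_])
  open import Data.Vec.Base using ([]; _∷_; here; there; tabulate)
  open import Data.Vec.Properties using (lookup⇒[]=; []=⇒lookup; lookup∘tabulate)
  open import Level using (0ℓ)
  open import Relation.Binary.PropositionalEquality hiding ([_])
  open import Relation.Nullary using (yes; no; contradiction; does)
  open import Relation.Nullary.Decidable using (_×-dec_; ¬?; decidable-stable; dec-true)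
  open import Relation.Unary using (Pred; Decidable)

  private
    variable
      n : ℕ

  ⟪_⟫ : {P : Pred (Fin n) 0ℓ} → Decidable P → Subset n
  ⟪ P? ⟫ = tabulate λ x → does (P? x)

  module _ {P : Pred (Fin n) 0ℓ} (P? : Decidable P) where

    ∈⟪⟫⁺ : ∀ {x} → P x → x ∈ ⟪ P? ⟫
    ∈⟪⟫⁺ {x} Px = lookup⇒[]= x _ (trans (lookup∘tabulate _ x) (dec-true (P? x) Px))

    ∈⟪⟫⁻ : ∀ {x} → x ∈ ⟪ P? ⟫ → P x
    ∈⟪⟫⁻ {x} x∈ with P? x | trans (sym (lookup∘tabulate (λ x → does (P? x)) x)) ([]=⇒lookup x∈)
    ... | yes Px | _ = Px

  ∣p∣<∣q∣⇒∃ : ∀ (p q : Subset n) → ∣ p ∣ < ∣ q ∣ → ∃ λ x → x ∈ q × x ∉ p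
  ∣p∣<∣q∣⇒∃ p q p<q with any? (λ x → (x ∈? q) ×-dec ¬? (x ∈? p))
  ... | yes found = found
  ... | no  none  = contradiction
    (p⊆q⇒∣p∣≤∣q∣ λ {x} x∈q → decidable-stable (x ∈? p) λ x∉p → none (x , x∈q , x∉p)) (<⇒≱ p<q)

  ⊆∧∣∣≡⇒≡ : {p q : Subset n} → p ⊆ q → ∣ p ∣ ≡ ∣ q ∣ → p ≡ q
  ⊆∧∣∣≡⇒≡ {p = p} p⊆q eq = ⊆-antisym p⊆q λ {x} x∈q → decidable-stable (x ∈? p)
    λ x∉p → <-irrefl eq (p⊂q⇒∣p∣<∣q∣ (p⊆q , x , x∈q , x∉p))

  ∪-⊆ : {p q s : Subset n} → p ⊆ s → q ⊆ s → p ∪ q ⊆ s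
  ∪-⊆ {p = p} {q} p⊆s q⊆s x∈ = [ p⊆s , q⊆s ] (x∈p∪q⁻ p q x∈)

  ⁅x⁆⊆ : ∀ {x} {p : Subset n} → x ∈ p → ⁅ x ⁆ ⊆ p
  ⁅x⁆⊆ {x = x} {p} x∈p y∈ = subst (_∈ p) (sym (x∈⁅y⁆⇒x≡y x y∈)) x∈p

  x∈p∪⁅x⁆ : ∀ {x} (p : Subset n) → x ∈ p ∪ ⁅ x ⁆
  x∈p∪⁅x⁆ p = q⊆p∪q p _ (x∈⁅x⁆ _)

  ∣p∪⁅x⁆∣ : ∀ (p : Subset n) {x} → x ∉ p → ∣ p ∪ ⁅ x ⁆ ∣ ≡ suc ∣ p ∣
  ∣p∪⁅x⁆∣ (inside  ∷ p) {zero}  x∉ = contradiction here x∉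
  ∣p∪⁅x⁆∣ (outside ∷ p) {zero}  x∉ rewrite ∪-identityʳ p = refl
  ∣p∪⁅x⁆∣ (inside  ∷ p) {suc x} x∉ = cong suc (∣p∪⁅x⁆∣ p λ x∈ → x∉ (there x∈))
  ∣p∪⁅x⁆∣ (outside ∷ p) {suc x} x∉ = ∣p∪⁅x⁆∣ p λ x∈ → x∉ (there x∈)

  p∪⁅x⁆≡q : ∀ {p q : Subset n} {x} → p ⊆ q → ∣ q ∣ ≡ suc ∣ p ∣ → x ∈ q → x ∉ p → p ∪ ⁅ x ⁆ ≡ q
  p∪⁅x⁆≡q {p = p} p⊆q eq x∈q x∉p = ⊆∧∣∣≡⇒≡ (∪-⊆ p⊆q (⁅x⁆⊆ x∈q)) (trans (∣p∪⁅x⁆∣ p x∉p) (sym eq))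

  x∈p─q⇒x∉q : ∀ (p q : Subset n) {x} → x ∈ p ─ q → x ∉ q
  x∈p─q⇒x∉q (_ ∷ p) (outside ∷ q) (there x∈) (there x∈q) = x∈p─q⇒x∉q p q x∈ x∈q
  x∈p─q⇒x∉q (_ ∷ p) (inside  ∷ q) (there x∈) (there x∈q) = x∈p─q⇒x∉q p q x∈ x∈q

  ∣p─q∣+∣q∣ : ∀ {p q : Subset n} → q ⊆ p → ∣ p ─ q ∣ + ∣ q ∣ ≡ ∣ p ∣
  ∣p─q∣+∣q∣ {p = []}          {[]}          q⊆p = refl
  ∣p─q∣+∣q∣ {p = inside  ∷ p} {inside  ∷ q} q⊆p = trans (+-suc ∣ p ─ q ∣ ∣ q ∣) (cong suc (∣p─q∣+∣q∣ (drop-∷-⊆ q⊆p)))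
  ∣p─q∣+∣q∣ {p = outside ∷ p} {inside  ∷ q} q⊆p with () ← q⊆p here
  ∣p─q∣+∣q∣ {p = inside  ∷ p} {outside ∷ q} q⊆p = cong suc (∣p─q∣+∣q∣ (drop-∷-⊆ q⊆p))
  ∣p─q∣+∣q∣ {p = outside ∷ p} {outside ∷ q} q⊆p = ∣p─q∣+∣q∣ (drop-∷-⊆ q⊆p)

  suc-∣p-x∣ : ∀ {p : Subset n} {x} → x ∈ p → suc ∣ p - x ∣ ≡ ∣ p ∣
  suc-∣p-x∣ {p = p} {x} x∈p = trans (+-comm 1 ∣ p - x ∣)
    (trans (cong (∣ p - x ∣ +_) (sym (∣⁅x⁆∣≡1 x))) (∣p─q∣+∣q∣ (⁅x⁆⊆ x∈p)))

  x∉p-x : ∀ (p : Subset n) x → x ∉ p - x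
  x∉p-x p x x∈ = x∈p─q⇒x∉q p ⁅ x ⁆ x∈ (x∈⁅x⁆ x)

  -- The least `k` elements of `p`, or all of `p` if it has fewer. It supplies a choice that depends
  -- on the set alone, so all sets spanning one hyperplane agree on its basis.
  first : ℕ → Subset n → Subset n
  first zero    p             = ⊥
  first (suc k) []            = []
  first (suc k) (inside  ∷ p) = inside ∷ first k p
  first (suc k) (outside ∷ p) = outside ∷ first (suc k) p

  first-⊆ : ∀ k (p : Subset n) → first k p ⊆ p
  first-⊆ zero    p             x∈         = contradiction x∈ ∉⊥
  first-⊆ (suc k) (inside  ∷ p) here       = here
  first-⊆ (suc k) (inside  ∷ p) (there x∈) = there (first-⊆ k p x∈)
  first-⊆ (suc k) (outside ∷ p) (there x∈) = there (first-⊆ (suc k) p x∈)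

  first-mono : ∀ k (p : Subset n) → first k p ⊆ first (suc k) p
  first-mono zero    p             x∈         = contradiction x∈ ∉⊥
  first-mono (suc k) (inside  ∷ p) here       = here
  first-mono (suc k) (inside  ∷ p) (there x∈) = there (first-mono k p x∈)
  first-mono (suc k) (outside ∷ p) (there x∈) = there (first-mono (suc k) p x∈)

  ∣first∣ : ∀ {k} (p : Subset n) → k ≤ ∣ p ∣ → ∣ first k p ∣ ≡ k
  ∣first∣ {n} {zero}  p             k≤      = ∣⊥∣≡0 n
  ∣first∣ {k = suc k} (inside  ∷ p) (s≤s k≤) = cong suc (∣first∣ p k≤)
  ∣first∣ {k = suc k} (outside ∷ p) k≤       = ∣first∣ p k≤

  elements : Subset n → List (Fin n)
  elements []            = []
  elements (inside  ∷ p) = zero ∷ List.map suc (elements p)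
  elements (outside ∷ p) = List.map suc (elements p)

  length-elements : ∀ (p : Subset n) → List.length (elements p) ≡ ∣ p ∣
  length-elements []            = refl
  length-elements (inside  ∷ p) = cong suc (trans (length-map suc (elements p)) (length-elements p))
  length-elements (outside ∷ p) = trans (length-map suc (elements p)) (length-elements p)

  ∈-elements⁻ : ∀ (p : Subset n) {x} → x List.∈ elements p → x ∈ p
  ∈-elements⁻ (inside  ∷ p) (here refl) = here
  ∈-elements⁻ (inside  ∷ p) (there x∈) with Listₚ.∈-map⁻ suc x∈
  ... | _ , y∈ , refl = there (∈-elements⁻ p y∈)
  ∈-elements⁻ (outside ∷ p) x∈ with Listₚ.∈-map⁻ suc x∈
  ... | _ , y∈ , refl = there (∈-elements⁻ p y∈)

  unique-elements : ∀ (p : Subset n) → Unique (elements p)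
  unique-elements []            = []
  unique-elements (inside  ∷ p) =
    Allₚ.map⁺ (All.universal (λ _ ()) (elements p)) ∷ map⁺ (λ { refl → refl }) (unique-elements p)
  unique-elements (outside ∷ p) = map⁺ (λ { refl → refl }) (unique-elements p)

open SubsetFacts

-- Encoding a paving matroid by a short list of dependent sets.

module PavingCode where
  open import Defs using (IsMatroid; IsPavingMatroid)
  open import Data.Fin.Base using (Fin)
  open import Data.Fin.Properties using (any?)
  open import Data.Fin.Subset
  open import Data.Fin.Subset.Properties
  open import Data.List.Base as List using (List; _∷_)
  import Data.List.Membership.Propositional as List
  import Data.List.Membership.Propositional.Properties as Listₚ
  open import Data.List.Properties using (length-map)
  import Data.List.Relation.Unary.All as All
  open import Data.List.Relation.Unary.AllPairs using (_∷_)
  open import Data.List.Relation.Unary.Any using (here; there)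
  open import Data.List.Relation.Unary.Unique.Propositional using (Unique)
  import Data.List.Relation.Unary.Unique.Propositional.Properties as Uniqueₚ
  open import Data.Nat.Base using (ℕ; zero; suc; _+_; _*_; _≤_; s≤s; s≤s⁻¹)
  open import Data.Nat.Combinatorics using (_C_)
  open import Data.Nat.Properties
    using (≤-refl; ≤-reflexive; ≤-trans; <-≤-trans; n≤1+n; m≤m+n; <⇒≱; +-comm; +-cancelʳ-≡; suc-injective; _≟_; m≤n⇒m<n∨m≡n)
  open import Data.Product.Base using (_×_; _,_; proj₁; proj₂; ∃)
  open import Data.Sum.Base using (_⊎_; inj₁; inj₂)
  open import Level using (0ℓ)
  open import Relation.Binary.PropositionalEquality hiding ([_])
  open import Relation.Nullary using (Dec; yes; no; ¬_; contradiction)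
  open import Relation.Nullary.Decidable using (_×-dec_; _⊎-dec_; ¬?; decidable-stable)
  open import Relation.Unary using (Pred; Decidable)

  -- The rank is `3 + k`, which builds in r ≥ 3. Nothing about matroids is assumed here, so that the
  -- code is a total function on families and can serve as the map of an injection.
  module Code {n : ℕ} (k : ℕ) {ℐ : Pred (Subset n) 0ℓ} (ℐ? : Decidable ℐ) where

    -- Matroid closure, provided `S` is independent. It is used for sets of size `2 + k`, which are
    -- independent in a paving matroid and span hyperplanes.
    cl : Subset n → Subset n
    cl S = ⟪ (λ x → (x ∈? S) ⊎-dec ¬? (ℐ? (S ∪ ⁅ x ⁆))) ⟫

    -- A dependent `D` of size `3 + k` is not a legitimate argument of `cl`, so the hyperplane
    -- through it is spanned by an independent part of it.
    flat : Subset n → Subset n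
    flat D = cl (first (2 + k) D)

    Key : Subset n → Set
    Key D = ¬ ℐ D × first (2 + k) (flat D) ⊆ D

    Key? : Decidable Key
    Key? D = ¬? (ℐ? D) ×-dec (first (2 + k) (flat D) ⊆? D)

    -- Every hyperplane H with more than 2 + k elements is recorded by the sets B ∪ {h},
    -- where B consists of the first 2 + k elements of H and h ∈ H ∖ B.
    code : List (Subset n)
    code = List.filter Key? (subsetsOfSize n (3 + k))

    p⊆cl : ∀ {S} → S ⊆ cl S
    p⊆cl {S} x∈S = ∈⟪⟫⁺ (λ x → (x ∈? S) ⊎-dec ¬? (ℐ? (S ∪ ⁅ x ⁆))) (inj₁ x∈S)

    ∈-cl⁺ : ∀ {S x} → ¬ ℐ (S ∪ ⁅ x ⁆) → x ∈ cl S
    ∈-cl⁺ {S} ¬ℐ = ∈⟪⟫⁺ (λ x → (x ∈? S) ⊎-dec ¬? (ℐ? (S ∪ ⁅ x ⁆))) (inj₂ ¬ℐ)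

    ∈-cl⁻ : ∀ {S x} → x ∈ cl S → x ∉ S → ¬ ℐ (S ∪ ⁅ x ⁆)
    ∈-cl⁻ {S} x∈ x∉S with ∈⟪⟫⁻ (λ x → (x ∈? S) ⊎-dec ¬? (ℐ? (S ∪ ⁅ x ⁆))) x∈
    ... | inj₁ x∈S = contradiction x∈S x∉S
    ... | inj₂ ¬ℐ  = ¬ℐ

  module Paving {n : ℕ} (k : ℕ) {ℐ : Pred (Subset n) 0ℓ} (ℐ? : Decidable ℐ)
                (isPaving : IsPavingMatroid (3 + k) ℐ) where
    open Code k ℐ?
    open IsPavingMatroid isPaving
    open IsMatroid isMatroid

    -- A minimal dependent set is a circuit, hence too large. The induction on a size bound shows
    -- that all proper subsets of `A` are independent, so `A` would itself be a circuit.
    small⇒indep : ∀ A → ∣ A ∣ ≤ 2 + k → ℐ A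
    small⇒indep A A≤ = go _ A ≤-refl A≤
      where
      go : ∀ m A → ∣ A ∣ ≤ m → ∣ A ∣ ≤ 2 + k → ℐ A
      go m A A≤m A≤ = decidable-stable (ℐ? A) λ ¬ℐA →
        contradiction (paving A (¬ℐA , proper m A≤m)) (<⇒≱ (s≤s A≤))
        where
        proper : ∀ m → ∣ A ∣ ≤ m → ∀ B → B ⊂ A → ℐ B
        proper zero    A≤0 B B⊂A with () ← <-≤-trans (p⊂q⇒∣p∣<∣q∣ B⊂A) A≤0
        proper (suc m) A≤m B B⊂A = go m B (s≤s⁻¹ (<-≤-trans (p⊂q⇒∣p∣<∣q∣ B⊂A) A≤m))
          (≤-trans (p⊆q⇒∣p∣≤∣q∣ (proj₁ B⊂A)) A≤)

    -- Were `T` independent, it would augment the smaller independent set `S` by some `x`; but `x`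
    -- lies in `cl S` outside `S`, so `S ∪ ⁅ x ⁆` is dependent.
    ⊆cl⇒dependent : ∀ {S T} → ∣ S ∣ ≡ 2 + k → ∣ T ∣ ≡ 3 + k → T ⊆ cl S → ¬ ℐ T
    ⊆cl⇒dependent {S} {T} ∣S∣ ∣T∣ T⊆clS ℐT =
      let x , x∈T , x∉S , ℐS∪x = augment S T (small⇒indep S (≤-reflexive ∣S∣)) ℐT
                                   (≤-reflexive (trans (cong suc ∣S∣) (sym ∣T∣)))
      in  ∈-cl⁻ (T⊆clS x∈T) x∉S ℐS∪x

    cl-⊆ : ∀ {S T} → ∣ S ∣ ≡ 2 + k → ∣ T ∣ ≡ 2 + k → T ⊆ cl S → cl S ⊆ cl T
    cl-⊆ {S} {T} ∣S∣ ∣T∣ T⊆clS {z} z∈ with z ∈? T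
    ... | yes z∈T = p⊆cl z∈T
    ... | no  z∉T = ∈-cl⁺ (⊆cl⇒dependent ∣S∣ (trans (∣p∪⁅x⁆∣ T z∉T) (cong suc ∣T∣)) (∪-⊆ T⊆clS (⁅x⁆⊆ z∈)))

    -- Uniqueness of the hyperplane through a set of size `2 + k`: any such subset of a hyperplane
    -- spans all of it. Charges of different hyperplanes are disjoint for this reason.
    cl-≡ : ∀ {S T} → ∣ S ∣ ≡ 2 + k → ∣ T ∣ ≡ 2 + k → T ⊆ cl S → cl T ≡ cl S
    cl-≡ ∣S∣ ∣T∣ T⊆clS = ⊆-antisym (cl-⊆ ∣T∣ ∣S∣ (λ x∈S → clS⊆clT (p⊆cl x∈S))) clS⊆clT
      where clS⊆clT = cl-⊆ ∣S∣ ∣T∣ T⊆clS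

    module _ (D : Subset n) (∣D∣ : ∣ D ∣ ≡ 3 + k) where

      private
        F = first (2 + k) D

        ∣F∣ : ∣ F ∣ ≡ 2 + k
        ∣F∣ = ∣first∣ D (≤-trans (n≤1+n _) (≤-reflexive (sym ∣D∣)))

      ⊆flat⇒dependent : ∀ {T} → ∣ T ∣ ≡ 3 + k → T ⊆ flat D → ¬ ℐ T
      ⊆flat⇒dependent = ⊆cl⇒dependent ∣F∣

      cl≡flat : ∀ {T} → ∣ T ∣ ≡ 2 + k → T ⊆ flat D → cl T ≡ flat D
      cl≡flat = cl-≡ ∣F∣

      flat≡flat : ∀ {T} → ∣ T ∣ ≡ 3 + k → T ⊆ flat D → flat T ≡ flat D
      flat≡flat {T} ∣T∣ T⊆ = cl≡flat (∣first∣ T (≤-trans (n≤1+n _) (≤-reflexive (sym ∣T∣))))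
        (λ x∈ → T⊆ (first-⊆ (2 + k) T x∈))

      dependent⇒⊆flat : ¬ ℐ D → D ⊆ flat D
      dependent⇒⊆flat ¬ℐD {x} x∈D with x ∈? F
      ... | yes x∈F = p⊆cl x∈F
      ... | no  x∉F = ∈-cl⁺ (subst (λ A → ¬ ℐ A)
        (sym (p∪⁅x⁆≡q (first-⊆ (2 + k) D) (trans ∣D∣ (cong suc (sym ∣F∣))) x∈D x∉F)) ¬ℐD)

    -- D = b ∪ {h} is charged to the 2 + k sets D ∖ {s}, s ∈ b, and to one extra set: b itself
    -- if D is the set D₀ recorded first for its hyperplane, and otherwise D ∪ D₀ with two
    -- elements of b removed, which is where r ≥ 3 enters.
    extra : ∀ {D D₀ : Subset n} (b : Subset n) → Dec (∃ λ y → y ∈ D₀ × y ∉ D) → Subset n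
    extra {D} b (yes (y , _)) = D ∪ ⁅ y ⁆ ─ first 2 b
    extra {D} b (no  _)       = b

    missing? : ∀ (D D₀ : Subset n) → Dec (∃ λ y → y ∈ D₀ × y ∉ D)
    missing? D D₀ = any? λ y → (y ∈? D₀) ×-dec ¬? (y ∈? D)

    -- Both depend on `D` only through its hyperplane; `basis⁺` adds the next element and is the set
    -- D₀.
    basis basis⁺ : Subset n → Subset n
    basis  D = first (2 + k) (flat D)
    basis⁺ D = first (3 + k) (flat D)

    charged : Subset n → List (Subset n)
    charged D = extra (basis D) (missing? D (basis⁺ D)) ∷ List.map (D -_) (elements (basis D))

    -- What a charged set `T` must remember for `D` to be recovered from `b` and `D₀`. In the first
    -- case `D₀ ⊆ D`, with equal sizes, forces D = D₀; in the second `T` keeps the element of `D`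
    -- outside `b`.
    Charge : (b D₀ D T : Subset n) → Set
    Charge b D₀ D T = (T ≡ b × D₀ ⊆ D) ⊎ ((∀ {x} → x ∈ D → x ∉ b → x ∈ T) × T ⊆ D ∪ D₀)

    Charge-injective : ∀ {b D₀ D D′ T} → ∣ b ∣ ≡ 2 + k → ∣ D₀ ∣ ≡ 3 + k → ∣ D ∣ ≡ 3 + k → ∣ D′ ∣ ≡ 3 + k →
      b ⊆ D₀ → b ⊆ D → b ⊆ D′ → Charge b D₀ D T → Charge b D₀ D′ T → D ≡ D′
    Charge-injective {b} {D₀} {D} {D′} ∣b∣ ∣D₀∣ ∣D∣ ∣D′∣ b⊆D₀ b⊆D b⊆D′ = go
      where
      outside-b : ∀ X → ∣ X ∣ ≡ 3 + k → ∃ λ h → h ∈ X × h ∉ b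
      outside-b X ∣X∣ = ∣p∣<∣q∣⇒∃ b X (≤-reflexive (trans (cong suc ∣b∣) (sym ∣X∣)))

      agree : ∀ {X Y h} → ∣ X ∣ ≡ 3 + k → ∣ Y ∣ ≡ 3 + k → b ⊆ X → b ⊆ Y → h ∉ b → h ∈ X → h ∈ Y → X ≡ Y
      agree ∣X∣ ∣Y∣ b⊆X b⊆Y h∉b h∈X h∈Y = trans
        (sym (p∪⁅x⁆≡q b⊆X (trans ∣X∣ (cong suc (sym ∣b∣))) h∈X h∉b))
        (p∪⁅x⁆≡q b⊆Y (trans ∣Y∣ (cong suc (sym ∣b∣))) h∈Y h∉b)

      go : ∀ {T} → Charge b D₀ D T → Charge b D₀ D′ T → D ≡ D′
      go (inj₁ (_ , D₀⊆D)) (inj₁ (_ , D₀⊆D′)) = trans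
        (sym (⊆∧∣∣≡⇒≡ D₀⊆D (trans ∣D₀∣ (sym ∣D∣)))) (⊆∧∣∣≡⇒≡ D₀⊆D′ (trans ∣D₀∣ (sym ∣D′∣)))
      -- Here T = b, which cannot contain the element of `D′` outside `b`.
      go (inj₁ (refl , _)) (inj₂ (D′∖b⊆T , _)) =
        let h , h∈ , h∉ = outside-b D′ ∣D′∣ in contradiction (D′∖b⊆T h∈ h∉) h∉
      go (inj₂ (D∖b⊆T , _)) (inj₁ (refl , _)) =
        let h , h∈ , h∉ = outside-b D ∣D∣ in contradiction (D∖b⊆T h∈ h∉) h∉
      -- Both `h` and `h′` lie in `T`, hence in D′ ∪ D₀ and D ∪ D₀ respectively. If neither crosses
      -- over to the other set, both lie in `D₀`, and D = D₀ = D′.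
      go (inj₂ (D∖b⊆T , T⊆)) (inj₂ (D′∖b⊆T , T⊆′))
        with h , h∈D , h∉b ← outside-b D ∣D∣ | h′ , h′∈D′ , h′∉b ← outside-b D′ ∣D′∣
        with x∈p∪q⁻ D′ D₀ (T⊆′ (D∖b⊆T h∈D h∉b)) | x∈p∪q⁻ D D₀ (T⊆ (D′∖b⊆T h′∈D′ h′∉b))
      ... | inj₁ h∈D′ | _          = agree ∣D∣ ∣D′∣ b⊆D b⊆D′ h∉b h∈D h∈D′
      ... | _         | inj₁ h′∈D  = agree ∣D∣ ∣D′∣ b⊆D b⊆D′ h′∉b h′∈D h′∈D′
      ... | inj₂ h∈D₀ | inj₂ h′∈D₀ = trans (agree ∣D∣ ∣D₀∣ b⊆D b⊆D₀ h∉b h∈D h∈D₀)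
                                           (sym (agree ∣D′∣ ∣D₀∣ b⊆D′ b⊆D₀ h′∉b h′∈D′ h′∈D₀))

    module _ (D : Subset n) (∣D∣ : ∣ D ∣ ≡ 3 + k) (key : Key D) where

      private
        H = flat D
        b = basis D
        D₀ = basis⁺ D

        D⊆H : D ⊆ H
        D⊆H = dependent⇒⊆flat D ∣D∣ (proj₁ key)

      ∣basis⁺∣ : ∣ D₀ ∣ ≡ 3 + k
      ∣basis⁺∣ = ∣first∣ H (≤-trans (≤-reflexive (sym ∣D∣)) (p⊆q⇒∣p∣≤∣q∣ D⊆H))

      ∣basis∣ : ∣ b ∣ ≡ 2 + k
      ∣basis∣ = ∣first∣ H (≤-trans (n≤1+n _) (≤-trans (≤-reflexive (sym ∣D∣)) (p⊆q⇒∣p∣≤∣q∣ D⊆H)))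

      private
        ∣first2∣ : ∣ first 2 b ∣ ≡ 2
        ∣first2∣ = ∣first∣ b (≤-trans (m≤m+n 2 k) (≤-reflexive (sym ∣basis∣)))

        first2⊆D : first 2 b ⊆ D
        first2⊆D x∈ = proj₂ key (first-⊆ 2 b x∈)

        ∣extra∣ : ∀ dec → ∣ extra {D} {D₀} b dec ∣ ≡ 2 + k
        ∣extra∣ (no _)              = ∣basis∣
        ∣extra∣ (yes (y , _ , y∉D)) = +-cancelʳ-≡ 2 _ _ (begin
          ∣ D ∪ ⁅ y ⁆ ─ first 2 b ∣ + 2               ≡⟨ cong (∣ D ∪ ⁅ y ⁆ ─ first 2 b ∣ +_) ∣first2∣ ⟨
          ∣ D ∪ ⁅ y ⁆ ─ first 2 b ∣ + ∣ first 2 b ∣   ≡⟨ ∣p─q∣+∣q∣ (λ x∈ → p⊆p∪q ⁅ y ⁆ (first2⊆D x∈)) ⟩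
          ∣ D ∪ ⁅ y ⁆ ∣                               ≡⟨ ∣p∪⁅x⁆∣ D y∉D ⟩
          suc ∣ D ∣                                   ≡⟨ cong suc ∣D∣ ⟩
          4 + k                                       ≡⟨ +-comm 2 (2 + k) ⟩
          2 + k + 2                                   ∎)
          where open ≡-Reasoning

        Charge-extra : ∀ dec → Charge b D₀ D (extra {D} {D₀} b dec)
        Charge-extra (no none) = inj₁ (refl , λ {x} x∈D₀ →
          decidable-stable (x ∈? D) λ x∉D → none (x , x∈D₀ , x∉D))
        Charge-extra (yes (y , y∈D₀ , _)) = inj₂
          ( (λ x∈D x∉b → x∈p∧x∉q⇒x∈p─q (p⊆p∪q ⁅ y ⁆ x∈D) (λ x∈ → x∉b (first-⊆ 2 b x∈)))
          , λ x∈ → ∪-⊆ (p⊆p∪q D₀) (λ x∈y → q⊆p∪q D D₀ (⁅x⁆⊆ y∈D₀ x∈y)) (p─q⊆p (D ∪ ⁅ y ⁆) (first 2 b) x∈))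

        -- The witness of difference is `s` when the extra set is `b`, and otherwise the added `y`,
        -- which is not in `D`.
        extra≢ : ∀ dec {s} → s ∈ b → extra {D} {D₀} b dec ≢ D - s
        extra≢ (no _) {s} s∈b eq = x∉p-x D s (subst (s ∈_) eq s∈b)
        extra≢ (yes (y , y∈D₀ , y∉D)) {s} s∈b eq = y∉D (p─q⊆p D ⁅ s ⁆ (subst (y ∈_) eq
          (x∈p∧x∉q⇒x∈p─q (x∈p∪⁅x⁆ D) (λ y∈ → y∉D (first2⊆D y∈)))))

      -- Decoding happens in two stages: size and `T ⊆ H` recover the hyperplane as `cl T`, and then
      -- `Charge` recovers `D` inside it.
      ∈-charged : ∀ {T} → T List.∈ charged D → ∣ T ∣ ≡ 2 + k × T ⊆ H × Charge b D₀ D T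
      ∈-charged T∈ = let ∣T∣ , ch = size∧charge T∈ in ∣T∣ , charge⇒⊆ ch , ch
        where
        size∧charge : ∀ {T} → T List.∈ charged D → ∣ T ∣ ≡ 2 + k × Charge b D₀ D T
        size∧charge (here refl) = ∣extra∣ (missing? D D₀) , Charge-extra (missing? D D₀)
        size∧charge (there T∈) with s , s∈ , refl ← Listₚ.∈-map⁻ (D -_) T∈ =
          suc-injective (trans (suc-∣p-x∣ (proj₂ key s∈b)) ∣D∣) ,
          inj₂ ( (λ x∈D x∉b → x∈p∧x≢y⇒x∈p-y x∈D λ { refl → x∉b s∈b })
               , λ x∈ → p⊆p∪q D₀ (p─q⊆p D ⁅ s ⁆ x∈))
          where s∈b = ∈-elements⁻ b s∈

        charge⇒⊆ : ∀ {T} → Charge b D₀ D T → T ⊆ H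
        charge⇒⊆ (inj₁ (refl , _)) = first-⊆ (2 + k) H
        charge⇒⊆ (inj₂ (_ , T⊆)) x∈ = ∪-⊆ D⊆H (first-⊆ (3 + k) H) (T⊆ x∈)

      unique-charged : Unique (charged D)
      unique-charged =
        All.tabulate (λ T∈ eq → let s , s∈ , T≡ = Listₚ.∈-map⁻ (D -_) T∈ in
          extra≢ (missing? D D₀) (∈-elements⁻ b s∈) (trans eq T≡))
        ∷ unique-map (D -_) (unique-elements b) λ {s} {s′} s∈ s′∈ eq →
            decidable-stable (s Fin.≟ s′) λ s≢s′ →
              x∉p-x D s (subst (s ∈_) (sym eq) (x∈p∧x≢y⇒x∈p-y (proj₂ key (∈-elements⁻ b s∈)) s≢s′))
        where import Data.Fin.Properties as Fin

      length-charged : List.length (charged D) ≡ 3 + k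
      length-charged = cong suc (trans (length-map (D -_) (elements b)) (trans (length-elements b) ∣basis∣))

    ∈-code⁻ : ∀ {D} → D List.∈ code → ∣ D ∣ ≡ 3 + k × Key D
    ∈-code⁻ D∈ = let D∈′ , key = Listₚ.∈-filter⁻ Key? {xs = subsetsOfSize n (3 + k)} D∈
                 in  ∈-subsetsOfSize⁻ D∈′ , key

    length-code : List.length code * (3 + k) ≤ n C (2 + k)
    length-code = subst (List.length code * (3 + k) ≤_) (length-subsetsOfSize n (2 + k))
      (disjoint-lists⇒length*≤ charged (Uniqueₚ.filter⁺ Key? (unique-subsetsOfSize n (3 + k)))
        (λ {D} D∈ → let ∣D∣ , key = ∈-code⁻ D∈ in unique-charged D ∣D∣ key)
        (λ {D} D∈ → let ∣D∣ , key = ∈-code⁻ D∈ in length-charged D ∣D∣ key)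
        (λ {D} D∈ T∈ → let ∣D∣ , key = ∈-code⁻ D∈
                   in  ∈-subsetsOfSize⁺ (proj₁ (∈-charged D ∣D∣ key T∈)))
        λ {D} {D′} {T} D∈ D′∈ T∈ T∈′ →
          let ∣D∣ , key = ∈-code⁻ D∈
              ∣D′∣ , key′ = ∈-code⁻ D′∈
              ∣T∣ , T⊆H , ch = ∈-charged D ∣D∣ key T∈
              _ , T⊆H′ , ch′ = ∈-charged D′ ∣D′∣ key′ T∈′
              -- Both hyperplanes equal `cl T`, so `D` and `D′` share the same `b` and D₀, as
              -- `Charge-injective` requires.
              H′≡H = trans (sym (cl≡flat D′ ∣D′∣ ∣T∣ T⊆H′)) (cl≡flat D ∣D∣ ∣T∣ T⊆H)
          in  Charge-injective (∣basis∣ D ∣D∣ key) (∣basis⁺∣ D ∣D∣ key) ∣D∣ ∣D′∣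
                (first-mono (2 + k) (flat D)) (proj₂ key)
                (subst (λ H → first (2 + k) H ⊆ D′) H′≡H (proj₂ key′)) ch
                (subst (λ H → Charge (first (2 + k) H) (first (3 + k) H) D′ T) H′≡H ch′))

  module _ {n k : ℕ} {ℐ ℐ′ : Pred (Subset n) 0ℓ} (ℐ? : Decidable ℐ) (ℐ′? : Decidable ℐ′)
           (isPaving : IsPavingMatroid (3 + k) ℐ) (isPaving′ : IsPavingMatroid (3 + k) ℐ′) where

    private
      open module Code₁ = Code k ℐ? using (code; cl)
      module Code₂ = Code k ℐ′?
      module Paving₁ = Paving k ℐ? isPaving
      module Paving₂ = Paving k ℐ′? isPaving′

    -- The ℐ′-hyperplane `H` through `D` has every b ∪ {x} recorded. These sets are then recorded
    -- for ℐ as well, hence dependent there, which puts `H`, and so `D`, inside the ℐ-closure of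
    -- `b`.
    code-⊆⇒dependent : (∀ {D} → D List.∈ Code₂.code → D List.∈ code) →
      ∀ {D} → ∣ D ∣ ≡ 3 + k → ¬ ℐ′ D → ¬ ℐ D
    code-⊆⇒dependent code⊆ {D} ∣D∣ ¬ℐ′D = Paving₁.⊆cl⇒dependent ∣b∣ ∣D∣ (λ x∈D → H⊆cl (D⊆H x∈D))
      where
      H = Code₂.flat D
      b = first (2 + k) H

      D⊆H : D ⊆ H
      D⊆H = Paving₂.dependent⇒⊆flat D ∣D∣ ¬ℐ′D

      ∣b∣ : ∣ b ∣ ≡ 2 + k
      ∣b∣ = ∣first∣ H (≤-trans (n≤1+n _) (≤-trans (≤-reflexive (sym ∣D∣)) (p⊆q⇒∣p∣≤∣q∣ D⊆H)))

      b∪x∈code : ∀ {x} → x ∈ H → x ∉ b → b ∪ ⁅ x ⁆ List.∈ Code₂.code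
      b∪x∈code {x} x∈H x∉b = Listₚ.∈-filter⁺ Code₂.Key? (∈-subsetsOfSize⁺ ∣b∪x∣)
        ( Paving₂.⊆flat⇒dependent D ∣D∣ ∣b∪x∣ b∪x⊆H
        -- The new set spans `H` again, so its canonical basis is `b`, which it contains.
        , subst (λ H → first (2 + k) H ⊆ b ∪ ⁅ x ⁆) (sym (Paving₂.flat≡flat D ∣D∣ ∣b∪x∣ b∪x⊆H)) (p⊆p∪q ⁅ x ⁆))
        where
        ∣b∪x∣ : ∣ b ∪ ⁅ x ⁆ ∣ ≡ 3 + k
        ∣b∪x∣ = trans (∣p∪⁅x⁆∣ b x∉b) (cong suc ∣b∣)
        b∪x⊆H : b ∪ ⁅ x ⁆ ⊆ H
        b∪x⊆H = ∪-⊆ (first-⊆ (2 + k) H) (⁅x⁆⊆ x∈H)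

      H⊆cl : H ⊆ cl b
      H⊆cl {x} x∈H with x ∈? b
      ... | yes x∈b = Code₁.p⊆cl x∈b
      ... | no  x∉b = Code₁.∈-cl⁺ (proj₁ (proj₂ (Paving₁.∈-code⁻ (code⊆ (b∪x∈code x∈H x∉b)))))

    -- Sets below the rank are independent in both matroids and sets above it in neither, so the
    -- code only has to decide size `3 + k`.
    code-≡⇒⊆ : code ≡ Code₂.code → ∀ {A} → ℐ A → ℐ′ A
    code-≡⇒⊆ eq {A} ℐA with m≤n⇒m<n∨m≡n (proj₂ (IsPavingMatroid.hasRank isPaving) A ℐA)
    ... | inj₁ (s≤s A≤) = Paving₂.small⇒indep A A≤
    ... | inj₂ ∣A∣      = decidable-stable (ℐ′? A) λ ¬ℐ′A →
      code-⊆⇒dependent (subst (_ List.∈_) (sym eq)) ∣A∣ ¬ℐ′A ℐA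

open PavingCode

-- Binomial estimates in ℕ, including (1 + 1/d)^d ≤ Σ_{i≤d} 1/i!.

module NaturalBounds where
  open import Data.Nat.Base
  open import Data.Nat.Combinatorics using (_C_; nCk+nC[k+1]≡[n+1]C[k+1]; k>n⇒nCk≡0; nC1≡n)
  open import Data.Nat.Properties
  open import Data.Nat.Tactic.RingSolver using (solve-∀)
  open import Relation.Binary.PropositionalEquality

  -- The identity (k + 1) C(n, k + 1) = (n - k) C(n, k) with no subtraction.
  [k+1]*nC[k+1]+k*nCk≡n*nCk : ∀ n k → suc k * (n C suc k) + k * (n C k) ≡ n * (n C k)
  [k+1]*nC[k+1]+k*nCk≡n*nCk n zero = begin
    1 * (n C 1) + 0  ≡⟨ cong (λ x → 1 * x + 0) (nC1≡n n) ⟩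
    1 * n + 0        ≡⟨ lemma n ⟩
    n * 1            ∎
    where
    open ≡-Reasoning
    lemma : ∀ n → 1 * n + 0 ≡ n * 1
    lemma = solve-∀
  [k+1]*nC[k+1]+k*nCk≡n*nCk zero (suc k)
    rewrite k>n⇒nCk≡0 {0} {suc k} z<s | k>n⇒nCk≡0 {0} {2 + k} z<s =
    cong₂ _+_ (*-zeroʳ k) (*-zeroʳ k)
  [k+1]*nC[k+1]+k*nCk≡n*nCk (suc n) (suc k) = begin
    (2 + k) * (suc n C (2 + k)) + (1 + k) * (suc n C (1 + k))
      ≡⟨ cong₂ (λ x y → (2 + k) * x + (1 + k) * y)
           (nCk+nC[k+1]≡[n+1]C[k+1] n (suc k)) (nCk+nC[k+1]≡[n+1]C[k+1] n k) ⟨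
    (2 + k) * (b + c) + (1 + k) * (a + b)
      ≡⟨ lhs k a b c ⟩
    (b + ((2 + k) * c + (1 + k) * b)) + (a + ((1 + k) * b + k * a))
      ≡⟨ cong₂ (λ x y → (b + x) + (a + y))
           ([k+1]*nC[k+1]+k*nCk≡n*nCk n (suc k)) ([k+1]*nC[k+1]+k*nCk≡n*nCk n k) ⟩
    (b + n * b) + (a + n * a)
      ≡⟨ rhs n a b ⟩
    suc n * (a + b)
      ≡⟨ cong (suc n *_) (nCk+nC[k+1]≡[n+1]C[k+1] n k) ⟩
    suc n * (suc n C suc k) ∎
    where
    open ≡-Reasoning
    a = n C k
    b = n C suc k
    c = n C (2 + k)
    lhs : ∀ k a b c → (2 + k) * (b + c) + (1 + k) * (a + b) ≡ (b + ((2 + k) * c + (1 + k) * b)) + (a + ((1 + k) * b + k * a))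
    lhs = solve-∀
    rhs : ∀ n a b → (b + n * b) + (a + n * a) ≡ suc n * (a + b)
    rhs = solve-∀

  -- With k = r - 1 this is C(n, r - 1) d = N r, the source of the quotient N / d.
  nCk*[n∸k]≡nC[k+1]*[k+1] : ∀ n k → (n C k) * (n ∸ k) ≡ (n C suc k) * suc k
  nCk*[n∸k]≡nC[k+1]*[k+1] n k = begin
    (n C k) * (n ∸ k)                               ≡⟨ *-distribˡ-∸ (n C k) n k ⟩
    (n C k) * n ∸ (n C k) * k                       ≡⟨ cong₂ _∸_ (*-comm (n C k) n) (*-comm (n C k) k) ⟩
    n * (n C k) ∸ k * (n C k)                       ≡⟨ cong (_∸ k * (n C k)) ([k+1]*nC[k+1]+k*nCk≡n*nCk n k) ⟨
    (suc k * (n C suc k) + k * (n C k)) ∸ k * (n C k) ≡⟨ m+n∸n≡m _ (k * (n C k)) ⟩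
    suc k * (n C suc k)                             ≡⟨ *-comm (suc k) (n C suc k) ⟩
    (n C suc k) * suc k                             ∎
    where open ≡-Reasoning

  -- Dropping the subtracted term of the recurrence gives (k + 1) C(n, k + 1) ≤ n C(n, k), which is
  -- then iterated.
  nCk*k!≤n^k : ∀ n k → (n C k) * k ! ≤ n ^ k
  nCk*k!≤n^k n zero    = ≤-refl
  nCk*k!≤n^k n (suc k) = begin
    (n C suc k) * (suc k * k !)              ≡⟨ lemma (n C suc k) (suc k) (k !) ⟩
    suc k * (n C suc k) * k !                ≤⟨ *-monoˡ-≤ (k !) (m≤m+n (suc k * (n C suc k)) (k * (n C k))) ⟩
    (suc k * (n C suc k) + k * (n C k)) * k ! ≡⟨ cong (_* k !) ([k+1]*nC[k+1]+k*nCk≡n*nCk n k) ⟩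
    n * (n C k) * k !                        ≡⟨ *-assoc n (n C k) (k !) ⟩
    n * ((n C k) * k !)                      ≤⟨ *-monoʳ-≤ n (nCk*k!≤n^k n k) ⟩
    n * n ^ k                                ∎
    where
    open ≤-Reasoning
    lemma : ∀ a b c → a * (b * c) ≡ b * a * c
    lemma = solve-∀

  k≤n⇒nCk>0 : ∀ {n k} → k ≤ n → 0 < n C k
  k≤n⇒nCk>0 z≤n                     = z<s
  k≤n⇒nCk>0 (s≤s {k} {n} k≤n) = subst (0 <_) (nCk+nC[k+1]≡[n+1]C[k+1] n k)
    (≤-trans (k≤n⇒nCk>0 k≤n) (m≤m+n (n C k) (n C suc k)))

  -- expNumerator k = Σ_{i≤k} k! / i!
  expNumerator : ℕ → ℕ
  expNumerator zero    = 1
  expNumerator (suc k) = suc k * expNumerator k + 1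

  -- binomialSum d j k = Σ_{i≤k} C(j, i) d^(k-i)
  binomialSum : ℕ → ℕ → ℕ → ℕ
  binomialSum d j zero    = 1
  binomialSum d j (suc k) = d * binomialSum d j k + j C suc k

  -- Pascal's rule in each term: the part C(j, i) keeps its power of `d`, and the part C(j, i - 1)
  -- is reindexed into a sum one term shorter.
  binomialSum-suc : ∀ d j k → binomialSum d (suc j) (suc k) ≡ binomialSum d j (suc k) + binomialSum d j k
  binomialSum-suc d j zero = begin
    d * 1 + suc j C 1            ≡⟨ cong (d * 1 +_) (nCk+nC[k+1]≡[n+1]C[k+1] j 0) ⟨
    d * 1 + (1 + j C 1)          ≡⟨ lemma (d * 1) (j C 1) ⟩
    d * 1 + j C 1 + 1            ∎
    where
    open ≡-Reasoning
    lemma : ∀ a b → a + (1 + b) ≡ a + b + 1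
    lemma = solve-∀
  binomialSum-suc d j (suc k) = begin
    d * binomialSum d (suc j) (suc k) + suc j C (2 + k)
      ≡⟨ cong₂ (λ x y → d * x + y) (binomialSum-suc d j k) (sym (nCk+nC[k+1]≡[n+1]C[k+1] j (suc k))) ⟩
    d * (binomialSum d j (suc k) + binomialSum d j k) + (j C suc k + j C (2 + k))
      ≡⟨ lemma d (binomialSum d j (suc k)) (binomialSum d j k) (j C suc k) (j C (2 + k)) ⟩
    d * binomialSum d j (suc k) + j C (2 + k) + (d * binomialSum d j k + j C suc k) ∎
    where
    open ≡-Reasoning
    lemma : ∀ d x y a b → d * (x + y) + (a + b) ≡ d * x + b + (d * y + a)
    lemma = solve-∀

  -- The binomial theorem for (d + 1)^j; in the induction the surplus term C(j, j + 1) vanishes.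
  binomialSum-diagonal : ∀ d j → binomialSum d j j ≡ suc d ^ j
  binomialSum-diagonal d zero    = refl
  binomialSum-diagonal d (suc j) = begin
    binomialSum d (suc j) (suc j)
      ≡⟨ binomialSum-suc d j j ⟩
    d * binomialSum d j j + j C suc j + binomialSum d j j
      ≡⟨ cong (λ x → d * binomialSum d j j + x + binomialSum d j j) (k>n⇒nCk≡0 (n<1+n j)) ⟩
    d * binomialSum d j j + 0 + binomialSum d j j
      ≡⟨ lemma d (binomialSum d j j) ⟩
    suc d * binomialSum d j j
      ≡⟨ cong (suc d *_) (binomialSum-diagonal d j) ⟩
    suc d * suc d ^ j ∎
    where
    open ≡-Reasoning
    lemma : ∀ d x → d * x + 0 + x ≡ suc d * x
    lemma = solve-∀

  -- Term by term, C(d, i) d^(k-i) ≤ d^k / i!, because C(d, i) i! ≤ d^i; the common denominator is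
  -- k!.
  binomialSum*k!≤ : ∀ d k → binomialSum d d k * k ! ≤ d ^ k * expNumerator k
  binomialSum*k!≤ d zero    = ≤-refl
  binomialSum*k!≤ d (suc k) = begin
    (d * binomialSum d d k + d C suc k) * (suc k * k !)
      ≡⟨ lhs d (binomialSum d d k) (d C suc k) (suc k) (k !) ⟩
    d * suc k * (binomialSum d d k * k !) + (d C suc k) * (suc k * k !)
      ≤⟨ +-mono-≤ (*-monoʳ-≤ (d * suc k) (binomialSum*k!≤ d k)) (nCk*k!≤n^k d (suc k)) ⟩
    d * suc k * (d ^ k * expNumerator k) + d * d ^ k
      ≡⟨ rhs d (suc k) (d ^ k) (expNumerator k) ⟩
    d * d ^ k * (suc k * expNumerator k + 1) ∎
    where
    open ≤-Reasoning
    lhs : ∀ d x c m f → (d * x + c) * (m * f) ≡ d * m * (x * f) + c * (m * f)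
    lhs = solve-∀
    rhs : ∀ d m a s → d * m * (a * s) + d * a ≡ d * a * (m * s + 1)
    rhs = solve-∀

  [1+d]^d*d!≤d^d*expNumerator : ∀ d → suc d ^ d * d ! ≤ d ^ d * expNumerator d
  [1+d]^d*d!≤d^d*expNumerator d =
    subst (λ x → x * d ! ≤ d ^ d * expNumerator d) (binomialSum-diagonal d d) (binomialSum*k!≤ d d)

  ^-comm : ∀ a b c → (a ^ b) ^ c ≡ (a ^ c) ^ b
  ^-comm a b c = trans (^-*-assoc a b c) (trans (cong (a ^_) (*-comm b c)) (sym (^-*-assoc a c b)))

  ^-distribʳ-* : ∀ a b n → (a * b) ^ n ≡ a ^ n * b ^ n
  ^-distribʳ-* a b zero    = refl
  ^-distribʳ-* a b (suc n) = trans (cong (a * b *_) (^-distribʳ-* a b n)) (lemma a b (a ^ n) (b ^ n))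
    where
    lemma : ∀ a b x y → a * b * (x * y) ≡ a * x * (b * y)
    lemma = solve-∀

  -- The d-th power of the hypothesis, with (1 + 1/d)^d bounded by a partial sum of the series of e.
  power-bound : ∀ P d .{{_ : NonZero d}} m N → m * d ≤ N → P * d ^ N ≤ d ^ m * suc d ^ N →
    P ^ d * (d !) ^ N ≤ (d * expNumerator d) ^ N
  power-bound P d m N md≤N h = *-cancelʳ-≤ _ _ ((d ^ d) ^ N) {{m^n≢0 (d ^ d) N {{m^n≢0 d d}}}} (begin
    P ^ d * (d !) ^ N * (d ^ d) ^ N
      ≡⟨ cong (P ^ d * (d !) ^ N *_) (^-comm d d N) ⟩
    P ^ d * (d !) ^ N * (d ^ N) ^ d
      ≡⟨ swap (P ^ d) ((d !) ^ N) ((d ^ N) ^ d) ⟩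
    P ^ d * (d ^ N) ^ d * (d !) ^ N
      ≡⟨ cong (_* (d !) ^ N) (^-distribʳ-* P (d ^ N) d) ⟨
    (P * d ^ N) ^ d * (d !) ^ N
      ≤⟨ *-monoˡ-≤ ((d !) ^ N) (^-monoˡ-≤ d h) ⟩
    (d ^ m * suc d ^ N) ^ d * (d !) ^ N
      ≡⟨ cong (_* (d !) ^ N) (^-distribʳ-* (d ^ m) (suc d ^ N) d) ⟩
    (d ^ m) ^ d * (suc d ^ N) ^ d * (d !) ^ N
      ≡⟨ cong₂ (λ x y → x * y * (d !) ^ N) (^-*-assoc d m d) (^-comm (suc d) N d) ⟩
    d ^ (m * d) * (suc d ^ d) ^ N * (d !) ^ N
      -- Only here does the gap between `m` and the possibly fractional N / d get absorbed: after
      -- the d-th power the exponents are the integers m d and N.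
      ≤⟨ *-monoˡ-≤ ((d !) ^ N) (*-monoˡ-≤ ((suc d ^ d) ^ N) (^-monoʳ-≤ d md≤N)) ⟩
    d ^ N * (suc d ^ d) ^ N * (d !) ^ N
      ≡⟨ *-assoc (d ^ N) ((suc d ^ d) ^ N) ((d !) ^ N) ⟩
    d ^ N * ((suc d ^ d) ^ N * (d !) ^ N)
      ≡⟨ cong (d ^ N *_) (^-distribʳ-* (suc d ^ d) (d !) N) ⟨
    d ^ N * (suc d ^ d * d !) ^ N
      ≤⟨ *-monoʳ-≤ (d ^ N) (^-monoˡ-≤ N ([1+d]^d*d!≤d^d*expNumerator d)) ⟩
    d ^ N * (d ^ d * expNumerator d) ^ N
      ≡⟨ cong (d ^ N *_) (^-distribʳ-* (d ^ d) (expNumerator d) N) ⟩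
    d ^ N * ((d ^ d) ^ N * expNumerator d ^ N)
      ≡⟨ assoc (d ^ N) ((d ^ d) ^ N) (expNumerator d ^ N) ⟩
    d ^ N * expNumerator d ^ N * (d ^ d) ^ N
      ≡⟨ cong (_* (d ^ d) ^ N) (^-distribʳ-* d (expNumerator d) N) ⟨
    (d * expNumerator d) ^ N * (d ^ d) ^ N ∎)
    where
    open ≤-Reasoning
    swap : ∀ a b c → a * b * c ≡ a * c * b
    swap = solve-∀
    assoc : ∀ a b c → a * (b * c) ≡ a * c * b
    assoc = solve-∀

open NaturalBounds

-- Counting paving matroids by their codes.

module PavingCount where
  open import Defs using (p; families; isPavingMatroid?; _∈ˡ?_)
  open import Data.List.Base using (length; filter)
  open import Data.List.Membership.Propositional using (_∈_)
  open import Data.List.Membership.Propositional.Properties using (∈-filter⁺; ∈-filter⁻)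
  open import Data.List.Relation.Unary.Unique.Propositional.Properties using (filter⁺)
  open import Data.Nat.Base
  open import Data.Nat.Combinatorics using (_C_)
  open import Data.Nat.DivMod using (_/_; m/n*n≤m; m*n/n≡m; /-monoˡ-≤)
  open import Data.Nat.Properties
  open import Data.Nat.Tactic.RingSolver using (solve-∀)
  open import Data.Product.Base using (proj₁; proj₂)
  open import Relation.Binary.PropositionalEquality

  -- Equal codes give inclusions of independent sets in both directions, so coding is injective on
  -- the counted families. The bound on code length is left as a hypothesis to keep division out.
  p≤length-shortSublists : ∀ n k m → (∀ l → l * (3 + k) ≤ n C (2 + k) → l ≤ m) →
    p n (3 + k) ≤ length (shortSublists m (subsetsOfSize n (3 + k)))
  p≤length-shortSublists n k m bound = injection⇒length≤ (λ 𝓕 → Code.code k (_∈ˡ? 𝓕))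
    (filter⁺ Paving? (unique-sublists (unique-subsets n)))
    (λ {𝓕} 𝓕∈ → ∈-filter⁺ (λ 𝓓 → length 𝓓 ≤? m)
      (filter∈sublists (Code.Key? k (_∈ˡ? 𝓕)) (subsetsOfSize n (3 + k)))
      (bound _ (Paving.length-code k (_∈ˡ? 𝓕) (isPaving 𝓕∈))))
    (λ {𝓕} {𝓖} 𝓕∈ 𝓖∈ eq → sublists-ext (unique-subsets n) (family 𝓕∈) (family 𝓖∈)
      (code-≡⇒⊆ (_∈ˡ? 𝓕) (_∈ˡ? 𝓖) (isPaving 𝓕∈) (isPaving 𝓖∈) eq)
      (code-≡⇒⊆ (_∈ˡ? 𝓖) (_∈ˡ? 𝓕) (isPaving 𝓖∈) (isPaving 𝓕∈) (sym eq)))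
    where
    Paving? = λ 𝓕 → isPavingMatroid? (3 + k) {_∈ 𝓕} (_∈ˡ? 𝓕)

    family : ∀ {𝓕} → 𝓕 ∈ filter Paving? (families n) → 𝓕 ∈ families n
    family 𝓕∈ = proj₁ (∈-filter⁻ Paving? {xs = families n} 𝓕∈)

    isPaving = λ {𝓕} (𝓕∈ : 𝓕 ∈ filter Paving? (families n)) → proj₂ (∈-filter⁻ Paving? {xs = families n} 𝓕∈)

  p^d-bound : ∀ n k → 3 + k ≤ n → let d = suc (n ∸ (3 + k)); N = n C (3 + k) in
    p n (3 + k) ^ d * (d !) ^ N ≤ (d * expNumerator d) ^ N
  p^d-bound n k r≤n = power-bound (p n (3 + k)) d m N (m/n*n≤m N d) (begin
    p n (3 + k) * d ^ N
      ≤⟨ *-monoˡ-≤ (d ^ N) (p≤length-shortSublists n k m short) ⟩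
    length (shortSublists m (subsetsOfSize n (3 + k))) * d ^ N
      ≤⟨ subst (λ N → length (shortSublists m (subsetsOfSize n (3 + k))) * d ^ N ≤ d ^ m * suc d ^ N)
           (length-subsetsOfSize n (3 + k)) (length-shortSublists d m (subsetsOfSize n (3 + k))) ⟩
    d ^ m * suc d ^ N ∎)
    where
    open ≤-Reasoning
    d = suc (n ∸ (3 + k))
    N = n C (3 + k)
    m = N / d

    short : ∀ l → l * (3 + k) ≤ n C (2 + k) → l ≤ m
    short l l*r≤ = subst (_≤ m) (m*n/n≡m l d) (/-monoˡ-≤ d (*-cancelʳ-≤ (l * d) N (3 + k) (begin
      l * d * (3 + k)            ≡⟨ swap l d (3 + k) ⟩
      l * (3 + k) * d            ≤⟨ *-monoˡ-≤ d l*r≤ ⟩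
      -- `suc n ∸ (3 + k)` computes to `n ∸ (2 + k)`; that this truncated difference is `d` depends
      -- on r ≤ n.
      (n C (2 + k)) * d          ≡⟨ cong ((n C (2 + k)) *_) (+-∸-assoc 1 r≤n) ⟨
      (n C (2 + k)) * (n ∸ (2 + k)) ≡⟨ nCk*[n∸k]≡nC[k+1]*[k+1] n (2 + k) ⟩
      N * (3 + k)                ∎)))
      where
      swap : ∀ a b c → a * b * c ≡ a * c * b
      swap = solve-∀

open PavingCount

-- Transfer of the natural-number bound to ℚ.

module RationalBounds where
  open import Defs using (_^_; 1/_!; ∑1/_!)
  open import Algebra.Bundles using (module CommutativeRing)
  open import Data.Integer.Base as ℤ using (+_)
  import Data.Integer.Properties as ℤₚ
  open import Data.Nat.Base as ℕ using (ℕ; zero; suc; _!)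
  import Data.Nat.Coprimality as Coprime
  import Data.Nat.Properties as ℕₚ
  open import Data.Product.Base using (_×_; _,_; proj₁; proj₂)
  open import Data.Rational.Base hiding (1/_)
  open import Data.Rational.Properties
  open import Data.Rational.Solver using (module +-*-Solver)
  open import Data.Rational.Unnormalised.Base as ℚᵘ using (mkℚᵘ)
  import Data.Rational.Unnormalised.Properties as ℚᵘₚ
  open import Relation.Binary.PropositionalEquality
  open import Algebra.Properties.CommutativeSemiring.Exp
    (CommutativeRing.commutativeSemiring +-*-commutativeRing) public
    using (^-distrib-*; ^-assocʳ)
  open +-*-Solver using (solve; _:=_; _:+_; _:*_)

  ι : ℕ → ℚ
  ι m = + m / 1

  private
    ι≡mkℚ : ∀ m → ι m ≡ mkℚ (+ m) 0 (Coprime.sym (Coprime.1-coprimeTo m))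
    ι≡mkℚ m = normalize-coprime (Coprime.sym (Coprime.1-coprimeTo m))

  ι-* : ∀ m n → ι (m ℕ.* n) ≡ ι m * ι n
  ι-* m n rewrite ι≡mkℚ m | ι≡mkℚ n = cong (_/ 1) (ℤₚ.pos-* m n)

  ι-+ : ∀ m n → ι (m ℕ.+ n) ≡ ι m + ι n
  ι-+ m n rewrite ι≡mkℚ m | ι≡mkℚ n = cong (_/ 1)
    (trans (ℤₚ.pos-+ m n) (sym (cong₂ ℤ._+_ (ℤₚ.*-identityʳ (+ m)) (ℤₚ.*-identityʳ (+ n)))))

  ι-^ : ∀ m n → ι (m ℕ.^ n) ≡ ι m ^ n
  ι-^ m zero    = refl
  ι-^ m (suc n) = trans (ι-* m (m ℕ.^ n)) (cong (ι m *_) (ι-^ m n))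

  ι-mono-≤ : ∀ {m n} → m ℕ.≤ n → ι m ≤ ι n
  ι-mono-≤ {m} {n} m≤n rewrite ι≡mkℚ m | ι≡mkℚ n =
    *≤* (subst₂ ℤ._≤_ (sym (ℤₚ.*-identityʳ (+ m))) (sym (ℤₚ.*-identityʳ (+ n))) (ℤ.+≤+ m≤n))

  ι-pos : ∀ m .{{_ : ℕ.NonZero m}} → Positive (ι m)
  ι-pos m = normalize-pos m 1

  0≤ι : ∀ m → 0ℚ ≤ ι m
  0≤ι m = nonNegative⁻¹ (ι m) {{normalize-nonNeg m 1}}

  [i/m]*ιm : ∀ i m .{{_ : ℕ.NonZero m}} → (i / m) * ι m ≡ i / 1
  [i/m]*ιm i (suc m) = toℚᵘ-injective (begin
    toℚᵘ ((i / suc m) * ι (suc m))               ≈⟨ toℚᵘ-homo-* (i / suc m) (ι (suc m)) ⟩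
    toℚᵘ (i / suc m) ℚᵘ.* toℚᵘ (ι (suc m))       ≈⟨ ℚᵘₚ.*-cong (toℚᵘ-fromℚᵘ (mkℚᵘ i m)) (toℚᵘ-fromℚᵘ (mkℚᵘ (+ suc m) 0)) ⟩
    mkℚᵘ i m ℚᵘ.* mkℚᵘ (+ suc m) 0               ≈⟨ ℚᵘ.*≡* (ℤₚ.*-assoc i (+ suc m) (+ 1)) ⟩
    mkℚᵘ i 0                                     ≈⟨ toℚᵘ-fromℚᵘ (mkℚᵘ i 0) ⟨
    toℚᵘ (i / 1)                                 ∎)
    where open ℚᵘₚ.≃-Reasoning

  *-cancelʳ-≡-pos : ∀ {p q} r .{{_ : Positive r}} → p * r ≡ q * r → p ≡ q
  *-cancelʳ-≡-pos r eq = ≤-antisym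
    (*-cancelʳ-≤-pos r (≤-reflexive eq)) (*-cancelʳ-≤-pos r (≤-reflexive (sym eq)))

  ^-pos : ∀ y .{{_ : Positive y}} n → Positive (y ^ n)
  ^-pos y zero    = _
  ^-pos y (suc n) = pos*pos⇒pos y (y ^ n) {{^-pos y n}}

  ^-monoˡ-≤ : ∀ {y z} → 0ℚ ≤ y → y ≤ z → ∀ n → y ^ n ≤ z ^ n
  ^-monoˡ-≤ {y} {z} 0≤y y≤z n = proj₂ (go n)
    where
    go : ∀ n → 0ℚ ≤ y ^ n × y ^ n ≤ z ^ n
    go zero    = nonNegative⁻¹ 1ℚ , ≤-refl
    go (suc n) = let 0≤yⁿ , yⁿ≤zⁿ = go n in
        subst (_≤ y * y ^ n) (*-zeroʳ y) (*-monoˡ-≤-nonNeg y {{nonNegative 0≤y}} 0≤yⁿ)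
      , ≤-trans (*-monoʳ-≤-nonNeg (y ^ n) {{nonNegative 0≤yⁿ}} y≤z)
                (*-monoˡ-≤-nonNeg z {{nonNegative (≤-trans 0≤y y≤z)}} yⁿ≤zⁿ)

  -- Strictness matters: it places every partial sum properly inside the lower cut of `e`.
  ∑1/k!-mono-< : ∀ k → ∑1/ k ! < ∑1/ suc k !
  ∑1/k!-mono-< k = subst (_< ∑1/ suc k !) (+-identityʳ (∑1/ k !))
    (+-monoʳ-< (∑1/ k !) (positive⁻¹ _ {{normalize-pos 1 (k !) {{k ℕₚ.!≢0}}}}))

  ∑1/k!-pos : ∀ k → Positive (∑1/ suc k !)
  ∑1/k!-pos k = positive (<-≤-trans (positive⁻¹ 1ℚ) (go k))
    where
    go : ∀ k → 1ℚ ≤ ∑1/ suc k !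
    go zero    = ≤-refl
    go (suc k) = ≤-trans (go k) (<⇒≤ (∑1/k!-mono-< (suc k)))

  -- `∑1/ suc k !` stops at i = k, matching the range of `expNumerator k`; hence the shift by one.
  ∑1/k!*k! : ∀ k → ∑1/ suc k ! * ι (k !) ≡ ι (expNumerator k)
  ∑1/k!*k! zero    = refl
  ∑1/k!*k! (suc k) = begin
    (∑1/ suc k ! + 1/ suc k !) * ι (suc k !)
      ≡⟨ *-distribʳ-+ (ι (suc k !)) (∑1/ suc k !) (1/ suc k !) ⟩
    (∑1/ suc k !) * ι (suc k !) + (1/ suc k !) * ι (suc k !)
      ≡⟨ cong₂ _+_ (cong (∑1/ suc k ! *_) (ι-* (suc k) (k !))) ([i/m]*ιm (+ 1) (suc k !) {{suc k ℕₚ.!≢0}}) ⟩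
    ∑1/ suc k ! * (ι (suc k) * ι (k !)) + ι 1
      ≡⟨ cong (_+ ι 1) (swap (∑1/ suc k !) (ι (suc k)) (ι (k !))) ⟩
    ι (suc k) * (∑1/ suc k ! * ι (k !)) + ι 1
      ≡⟨ cong (λ x → ι (suc k) * x + ι 1) (∑1/k!*k! k) ⟩
    ι (suc k) * ι (expNumerator k) + ι 1
      ≡⟨ cong (_+ ι 1) (ι-* (suc k) (expNumerator k)) ⟨
    ι (suc k ℕ.* expNumerator k) + ι 1
      ≡⟨ ι-+ (suc k ℕ.* expNumerator k) 1 ⟨
    ι (expNumerator (suc k)) ∎
    where
    open ≡-Reasoning
    swap : ∀ a b c → a * (b * c) ≡ b * (a * c)
    swap = solve 3 (λ a b c → a :* (b :* c) := b :* (a :* c)) refl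

  ι-power-bound : ∀ P d N → P ℕ.^ d ℕ.* (d !) ℕ.^ N ℕ.≤ (d ℕ.* expNumerator d) ℕ.^ N →
    ι P ^ d ≤ (ι d * ∑1/ suc d !) ^ N
  ι-power-bound P d N h = *-cancelʳ-≤-pos (ι (d !) ^ N) {{^-pos (ι (d !)) {{ι-pos (d !) {{d ℕₚ.!≢0}}}} N}} (begin
    ι P ^ d * ι (d !) ^ N                        ≡⟨ cong₂ _*_ (ι-^ P d) (ι-^ (d !) N) ⟨
    ι (P ℕ.^ d) * ι ((d !) ℕ.^ N)                ≡⟨ ι-* (P ℕ.^ d) ((d !) ℕ.^ N) ⟨
    ι (P ℕ.^ d ℕ.* (d !) ℕ.^ N)                  ≤⟨ ι-mono-≤ h ⟩
    ι ((d ℕ.* expNumerator d) ℕ.^ N)             ≡⟨ ι-^ (d ℕ.* expNumerator d) N ⟩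
    ι (d ℕ.* expNumerator d) ^ N                 ≡⟨ cong (_^ N) (ι-* d (expNumerator d)) ⟩
    (ι d * ι (expNumerator d)) ^ N               ≡⟨ cong (λ x → (ι d * x) ^ N) (∑1/k!*k! d) ⟨
    (ι d * (∑1/ suc d ! * ι (d !))) ^ N          ≡⟨ cong (_^ N) (*-assoc (ι d) (∑1/ suc d !) (ι (d !))) ⟨
    (ι d * ∑1/ suc d ! * ι (d !)) ^ N            ≡⟨ ^-distrib-* (ι d * ∑1/ suc d !) (ι (d !)) N ⟩
    (ι d * ∑1/ suc d !) ^ N * ι (d !) ^ N        ∎)
    where open ≤-Reasoning

open RationalBounds

-- From a power inequality to an inequality of cuts.

module LogBound where
  open import Defs using (_∋_; _≤ᴿ_; Positive; fromℕ; fromℕ-positive; log₂; _·_; _÷_; 2^_; _^_)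
  open import Data.Integer.Base using (+_; -[1+_])
  open import Data.Nat.Base as ℕ using (ℕ; suc)
  import Data.Nat.Properties as ℕₚ
  open import Data.Product.Base using (_×_; _,_; ∃)
  open import Data.Rational.Base as ℚ hiding (Positive; _÷_)
  open import Data.Rational.Properties
  open import Data.Rational.Solver using (module +-*-Solver)
  open import Relation.Binary.PropositionalEquality
  open +-*-Solver using (solve; _:=_; _:*_)

  1≤^ : ∀ {z} → 1ℚ ≤ z → ∀ n → 1ℚ ≤ z ^ n
  1≤^ {z} 1≤z n = subst (_≤ z ^ n) (trans (sym (ι-^ 1 n)) (cong ι (ℕₚ.^-zeroˡ n))) (^-monoˡ-≤ (nonNegative⁻¹ 1ℚ) 1≤z n)

  -- A lower bound a / (b + 1) for log₂ P may be assumed nonnegative, since P ≥ 1.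
  nonNegative-exponent : ∀ {P} → 0 ℕ.< P → ∀ a b y → 0ℚ < y → y < ι P → 2^ a ≤ y ^ suc b →
    ∃ λ a₊ → a / suc b ≤ + a₊ / suc b × ι (2 ℕ.^ a₊) ≤ ι P ^ suc b
  nonNegative-exponent P>0 (+ a)    b y 0<y y<P h =
    a , ≤-refl , ≤-trans h (^-monoˡ-≤ (<⇒≤ 0<y) (<⇒≤ y<P) (suc b))
  nonNegative-exponent P>0 -[1+ a ] b y 0<y y<P h =
    0 , *-cancelʳ-≤-pos (ι (suc b)) {{ι-pos (suc b)}} (subst₂ _≤_
          (sym ([i/m]*ιm -[1+ a ] (suc b))) (sym ([i/m]*ιm (+ 0) (suc b)))
          (<⇒≤ (negative⁻¹ (- ι (suc a)) {{neg-pos {ι (suc a)} (ι-pos (suc a))}})))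
      , 1≤^ (ι-mono-≤ P>0) (suc b)

  -- If 2^a ≤ P^B then 2^(a d) ≤ P^(d B) ≤ z^(N B), so a d / (N B) is an admissible fraction for
  -- log₂ x, and N / d times it is a / B.
  log₂-fromℕ≤ : ∀ P (P>0 : 0 ℕ.< P) d .{{_ : ℕ.NonZero d}} N .{{_ : ℕ.NonZero N}} x (0∈x : Positive x) z →
    x ∋ z → 0ℚ < z → ι P ^ d ≤ z ^ N →
    log₂ (fromℕ P) (fromℕ-positive P P>0) ≤ᴿ (N · log₂ x 0∈x) ÷ d
  log₂-fromℕ≤ P P>0 d (suc N-1) x 0∈x z x∋z 0<z Pᵈ≤zᴺ q
    (_ , (a , b , y , refl , (_ , refl , y<P) , 0<y , 2^a≤yᵇ) , q<a/b)
    with a₊ , a/b≤a₊/b , 2^a₊≤Pᵇ ← nonNegative-exponent P>0 a b y 0<y y<P 2^a≤yᵇ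
    -- The target nests three suprema, for `÷ d`, `N ·` and `log₂`, each with a strict inequality;
    -- `m₁` and `m₂` split the interval from `q` to a₊ / B into the three gaps.
    with m₁ , q<m₁ , m₁<a₊/b ← <-dense (<-≤-trans q<a/b a/b≤a₊/b)
    with m₂ , m₁<m₂ , m₂<a₊/b ← <-dense m₁<a₊/b =
    m₁ , (ι d * m₁ , (ι N * (m₂ * c) , (m₂ * c , m₂c<log₂x , refl) , dm₁<Nm₂c) , m₁≡[1/d]*dm₁) , q<m₁
    where
    N B : ℕ
    N = suc N-1
    B = suc b
    c : ℚ
    c = ι d * (+ 1 / N)

    instance
      d-pos : ℚ.Positive (ι d)
      d-pos = ι-pos d
      c-pos : ℚ.Positive c
      c-pos = pos*pos⇒pos (ι d) (+ 1 / N) {{normalize-pos 1 N}}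

    m₁≡[1/d]*dm₁ : m₁ ≡ (+ 1 / d) * (ι d * m₁)
    m₁≡[1/d]*dm₁ = begin
      m₁                         ≡⟨ *-identityˡ m₁ ⟨
      1ℚ * m₁                    ≡⟨ cong (_* m₁) ([i/m]*ιm (+ 1) d) ⟨
      (+ 1 / d) * ι d * m₁       ≡⟨ *-assoc (+ 1 / d) (ι d) m₁ ⟩
      (+ 1 / d) * (ι d * m₁)     ∎
      where open ≡-Reasoning

    ιN*[m*c]≡ιd*m : ∀ m → ι N * (m * c) ≡ ι d * m
    ιN*[m*c]≡ιd*m m = begin
      ι N * (m * (ι d * (+ 1 / N)))   ≡⟨ lemma (ι N) m (ι d) (+ 1 / N) ⟩
      (+ 1 / N) * ι N * (ι d * m)     ≡⟨ cong (_* (ι d * m)) ([i/m]*ιm (+ 1) N) ⟩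
      1ℚ * (ι d * m)                  ≡⟨ *-identityˡ (ι d * m) ⟩
      ι d * m                         ∎
      where
      open ≡-Reasoning
      lemma : ∀ n m d u → n * (m * (d * u)) ≡ u * n * (d * m)
      lemma = solve 4 (λ n m d u → n :* (m :* (d :* u)) := u :* n :* (d :* m)) refl

    dm₁<Nm₂c : ι d * m₁ < ι N * (m₂ * c)
    dm₁<Nm₂c = subst (ι d * m₁ <_) (sym (ιN*[m*c]≡ιd*m m₂)) (*-monoʳ-<-pos (ι d) m₁<m₂)

    [a₊/b]*c≡ : (+ a₊ / B) * c ≡ + (a₊ ℕ.* d) / (N ℕ.* B)
    [a₊/b]*c≡ = *-cancelʳ-≡-pos (ι (N ℕ.* B)) {{ι-pos (N ℕ.* B)}} (begin
      (+ a₊ / B) * c * ι (N ℕ.* B)             ≡⟨ cong ((+ a₊ / B) * c *_) (ι-* N B) ⟩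
      (+ a₊ / B) * c * (ι N * ι B)             ≡⟨ lemma (+ a₊ / B) c (ι N) (ι B) ⟩
      ι N * ((+ a₊ / B) * c) * ι B             ≡⟨ cong (_* ι B) (ιN*[m*c]≡ιd*m (+ a₊ / B)) ⟩
      ι d * (+ a₊ / B) * ι B                   ≡⟨ *-assoc (ι d) (+ a₊ / B) (ι B) ⟩
      ι d * ((+ a₊ / B) * ι B)                 ≡⟨ cong (ι d *_) ([i/m]*ιm (+ a₊) B) ⟩
      ι d * ι a₊                               ≡⟨ *-comm (ι d) (ι a₊) ⟩
      ι a₊ * ι d                               ≡⟨ ι-* a₊ d ⟨
      ι (a₊ ℕ.* d)                             ≡⟨ [i/m]*ιm (+ (a₊ ℕ.* d)) (N ℕ.* B) ⟨
      (+ (a₊ ℕ.* d) / (N ℕ.* B)) * ι (N ℕ.* B) ∎)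
      where
      open ≡-Reasoning
      lemma : ∀ t c n b → t * c * (n * b) ≡ n * (t * c) * b
      lemma = solve 4 (λ t c n b → t :* c :* (n :* b) := n :* (t :* c) :* b) refl

    2^[a₊*d]≤z^[N*B] : ι (2 ℕ.^ (a₊ ℕ.* d)) ≤ z ^ (N ℕ.* B)
    2^[a₊*d]≤z^[N*B] = begin
      ι (2 ℕ.^ (a₊ ℕ.* d))    ≡⟨ cong ι (ℕₚ.^-*-assoc 2 a₊ d) ⟨
      ι ((2 ℕ.^ a₊) ℕ.^ d)    ≡⟨ ι-^ (2 ℕ.^ a₊) d ⟩
      ι (2 ℕ.^ a₊) ^ d        ≤⟨ ^-monoˡ-≤ (0≤ι (2 ℕ.^ a₊)) 2^a₊≤Pᵇ d ⟩
      (ι P ^ B) ^ d           ≡⟨ ^-assocʳ (ι P) B d ⟩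
      ι P ^ (B ℕ.* d)         ≡⟨ cong (ι P ^_) (ℕₚ.*-comm B d) ⟩
      ι P ^ (d ℕ.* B)         ≡⟨ ^-assocʳ (ι P) d B ⟨
      (ι P ^ d) ^ B           ≤⟨ ^-monoˡ-≤ 0≤Pᵈ Pᵈ≤zᴺ B ⟩
      (z ^ N) ^ B             ≡⟨ ^-assocʳ z N B ⟩
      z ^ (N ℕ.* B)           ∎
      where
      open ≤-Reasoning
      0≤Pᵈ : 0ℚ ≤ ι P ^ d
      0≤Pᵈ = ≤-trans (nonNegative⁻¹ 1ℚ) (1≤^ (ι-mono-≤ P>0) d)

    m₂c<log₂x : log₂ x 0∈x ∋ (m₂ * c)
    m₂c<log₂x = (+ a₊ / B) * c
              -- The second entry is N B - 1, since `log₂` takes the predecessor of the denominator.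
              , (+ (a₊ ℕ.* d) , b ℕ.+ N-1 ℕ.* B , z , [a₊/b]*c≡ , x∋z , 0<z , 2^[a₊*d]≤z^[N*B])
              , *-monoˡ-<-pos c m₂<a₊/b

open LogBound

-- A rational point below e d, and the conclusion.

open import Defs
open import Data.Nat.Base as ℕ using (ℕ; suc; _≤_; _∸_; s≤s; z≤n)
open import Data.Nat.Combinatorics using (_C_)
open import Data.Product.Base using (_,_)
import Data.Rational.Base as ℚ
import Data.Rational.Properties as ℚₚ
open import Relation.Binary.PropositionalEquality using (refl)

theorem1p4 : ∀ (n r : ℕ) → 3 ≤ r → (r≤n : r ≤ n) →
    log₂ (fromℕ (p n r)) (fromℕ-positive (p n r) (p-positive r≤n))
    ≤ᴿ ((n C r) · log₂ (suc (n ∸ r) · e) (·-positive (suc (n ∸ r)) e e-positive)) ÷ suc (n ∸ r)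
theorem1p4 n (suc (suc (suc k))) (s≤s (s≤s (s≤s z≤n))) r≤n =
  log₂-fromℕ≤ (p n r) (p-positive r≤n) d (n C r) {{ℕ.>-nonZero (k≤n⇒nCk>0 r≤n)}} (d · e) (·-positive d e e-positive) z z∈d·e
    (ℚₚ.positive⁻¹ z {{ℚₚ.pos*pos⇒pos (ι d) (∑1/ suc d !) {{∑1/k!-pos d}}}})
    (ι-power-bound (p n r) d (n C r) (p^d-bound n k r≤n))
  where
  r d : ℕ
  r = suc (suc (suc k))
  d = suc (n ∸ r)

  instance
    d-pos : ℚ.Positive (ι d)
    d-pos = ι-pos d

  z : ℚ.ℚ
  z = ι d ℚ.* ∑1/ suc d !

  z∈d·e : (d · e) ∋ z
  -- The cuts of `d · e` and of `e` each ask for a strictly larger witness, so one further partial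
  -- sum is used for each.
  z∈d·e = ι d ℚ.* ∑1/ suc (suc d) !
        , (∑1/ suc (suc d) ! , (∑1/ suc (suc (suc d)) ! , (suc (suc (suc d)) , refl) , ∑1/k!-mono-< (suc (suc d))) , refl)
        , ℚₚ.*-monoʳ-<-pos (ι d) (∑1/k!-mono-< (suc d))
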